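{- The number of families $\mathcal F\subseteq\mathcal P(n)$ for which there exists a partition $R\cup W=[n]$ such that $\mathcal F$ contains no pair $A,B$ that is comparable with monochromatic difference is $2^{\binom{n}{\lfloor n/2\rfloor}(1+o(1))}$, where $o(1)\to0$ as $n\to\infty$.
   Context: Given a partition (two-colouring) $R\cup W$ of $[n]$, a pair of sets $A,B\subseteq[n]$ is comparable with monochromatic difference if $A\subsetneq B$ and $B\setminus A\subseteq R$ or $B\setminus A\subseteq W$. -}

module Defs where

open import Data.Bool using (Bool; true; false; if_then_else_)
open import Data.Nat using (ℕ; zero; suc; _+_; _*_; _^_)
open import Data.Fin using (Fin; combine)
open import Data.Fin.Subset using (Subset; inside; outside; _∈_; _⊆_; _⊂_; _─_; ∁)
open import Data.Fin.Subset.Properties using (_∈?_; _⊆?_; _⊂?_; anySubset?)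
open import Data.Vec using ([]; _∷_)
open import Data.Product using (Σ; _×_)
open import Data.Sum using (_⊎_)
open import Function using (_∘_)
open import Relation.Nullary using (¬_; Dec; does)
open import Relation.Nullary.Decidable using (_×-dec_; _⊎-dec_; ¬?)

-- Binary code of a subset of [n] = Fin n as an element of Fin (2 ^ n).
-- This is a bijection Subset n ≅ Fin (2 ^ n); it is used only to index
-- the members of a family.
code : ∀ {n} → Subset n → Fin (2 ^ n)
code []            = Data.Fin.zero
code (false ∷ s)   = combine {2} Data.Fin.zero (code s)
code (true ∷ s)    = combine {2} (Data.Fin.suc Data.Fin.zero) (code s)

-- A family 𝓕 ⊆ 𝒫([n]), given by its characteristic vector over 𝒫([n]).
Family : ℕ → Set
Family n = Subset (2 ^ n)

_∈𝓕_ : ∀ {n} → Subset n → Family n → Set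
A ∈𝓕 𝓕 = code A ∈ 𝓕

-- Partition R ∪ W = [n] with W the complement of R.
-- (A , B) is comparable with monochromatic difference w.r.t. R:
-- A ⊊ B and B ∖ A ⊆ R or B ∖ A ⊆ W.
CompMono : ∀ {n} → Subset n → Subset n → Subset n → Set
CompMono R A B = A ⊂ B × ((B ─ A) ⊆ R ⊎ (B ─ A) ⊆ ∁ R)

AvoidsFor : ∀ {n} → Subset n → Family n → Set
AvoidsFor R 𝓕 = ¬ Σ _ (λ A → Σ _ (λ B → A ∈𝓕 𝓕 × B ∈𝓕 𝓕 × CompMono R A B))

Good : ∀ n → Family n → Set
Good n 𝓕 = Σ (Subset n) (λ R → AvoidsFor R 𝓕)

good? : ∀ n (𝓕 : Family n) → Dec (Good n 𝓕)
good? n 𝓕 = anySubset? (λ R → ¬? (anySubset? (λ A → anySubset? (λ B →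
  (code A ∈? 𝓕) ×-dec ((code B ∈? 𝓕) ×-dec
    ((A ⊂? B) ×-dec (((B ─ A) ⊆? R) ⊎-dec ((B ─ A) ⊆? ∁ R))))))))

count : ∀ {m} {P : Subset m → Set} → ((s : Subset m) → Dec (P s)) → ℕ
count {zero}  P? = if does (P? []) then 1 else 0
count {suc m} P? = count (P? ∘ (inside ∷_)) + count (P? ∘ (outside ∷_))

numGood : ℕ → ℕ
numGood n = count (good? n)

{-# OPTIONS --safe #-}
module Submission where

-- Lower bound: every subfamily of the middle layer is good.
--
-- Upper bound: for a fixed partition R ∪ W, the good families are the independent sets of the
-- graph on 𝒫([n]) joining comparable sets with monochromatic difference.  Supersaturation: if
-- a family has all degrees at most d = o(n) in this graph, then it has at most
-- (1 + o(1)) central n members.  To see this, take a random maximal chain of 𝒫(R), cut down to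
-- the ranks of a random chain of the symmetric chain decomposition, and likewise for W, so that
-- every set lies in the resulting grid with the same probability.  Without edges, the family meets each row and each
-- column of a grid at most once, and the shorter sides of the grids sum to central n by
-- Vandermonde's identity.  An edge costs only O(1 / n), because two distinct nonempty sets
-- rarely share a chain.  If one of R, W is small, chains in the other one alone suffice.
--
-- Branching on a vertex of degree at least d, while there is one, then yields at most
-- 2 ^ ((1 + o(1)) central n) independent sets, where d can be of order √n log n since
-- central n is of order 2 ^ n / √n.  The number 2 ^ n of partitions is negligible.

open import Defs
open import Data.Bool using (Bool; true; false)
import Data.Bool.Properties as Bool
open import Data.Empty using (⊥-elim)
open import Data.Fin as Fin using (Fin; _↑ˡ_)
open import Data.Fin.Properties as Fin using (combine-injective; combine-surjective)
open import Data.Fin.Subset using (Subset; inside; outside; ∣_∣; _∈_; _⊆_; _⊂_; _─_; ∁; ⊥)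
open import Data.Fin.Subset.Properties
  using (_∈?_; _⊆?_; _⊂?_; out⊆; in⊆in; drop-∷-⊆; ⊆-refl; ⊆-reflexive; ⊆-antisym; Empty-unique; ∉⊥; x∉p⇒x∈∁p; p─q⊆p;
         ∣p∣≤n; ∣⊥∣≡0; ∣∁p∣≡n∸∣p∣; p⊂q⇒∣p∣<∣q∣)
open import Data.List using (List; []; _∷_; _++_; map; length; filter; concatMap; cartesianProduct; upTo)
open import Data.List.Properties using (length-map; length-++; length-upTo; map-++; map-∘; map-cong; map-applyUpTo; filter-notAll)
open import Data.List.Membership.Propositional using (find; lose) renaming (_∈_ to _∈ˡ_)
open import Data.List.Membership.Propositional.Properties
  using (∈-filter⁺; ∈-filter⁻; ∈-map⁺; ∈-map⁻; ∈-upTo⁺; ∈-++⁺ˡ; ∈-++⁺ʳ; ∈-concatMap⁺; ∈-concatMap⁻)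
open import Data.List.Relation.Unary.All as All using ([])
open import Data.List.Relation.Unary.AllPairs using ([]; _∷_)
open import Data.List.Relation.Unary.Any using (any?; here; there)
open import Data.List.Relation.Unary.Unique.Propositional using (Unique)
open import Data.List.Relation.Unary.Unique.Propositional.Properties using (filter⁺; map⁺; ++⁺)
open import Data.Nat
open import Data.Nat.Combinatorics using (_C_; nCk+nC[k+1]≡[n+1]C[k+1]; nCk≡nC[n∸k]; nCk≡n!/k![n-k]!; k![n∸k]!∣n!)
open import Data.Nat.DivMod using (m/n≡1+[m∸n]/n; m/n*n≤m; m/n*n≡m; m*n/n≡m; /-monoˡ-≤)
open import Data.Nat.ListAction using (sum)
open import Data.Nat.ListAction.Properties using (sum-++)
open import Data.Nat.Properties
open import Data.Nat.Tactic.RingSolver using (solve-∀)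
open import Data.Product using (Σ; _×_; _,_; proj₁; proj₂; ∃)
open import Data.Sum using (_⊎_; inj₁; inj₂; [_,_]′)
open import Data.Vec as Vec using (Vec; []; _∷_; _[_]≔_; here; there)
open import Data.Vec.Properties
  using (≡-dec; ∷-injective; ∷-injectiveʳ; []≔-idempotent; []≔-lookup; []=⇒lookup; lookup⇒[]=; lookup∘update; lookup∘update′; lookup-++ˡ; lookup-++ʳ)
open import Function using (_∘_; id)
open import Relation.Binary.Definitions using (DecidableEquality)
open import Relation.Binary.PropositionalEquality
open import Relation.Nullary using (Dec; yes; no; ¬_; contradiction)
open import Relation.Nullary.Decidable using (_×-dec_; _⊎-dec_; ¬?)
open import Relation.Unary using (Decidable)

-- Finite sums

-- For families without edges the bound is the two-part Sperner theorem of Katona and Kleitman,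
-- which follows by cutting 𝒫(R) × 𝒫(W) into products of symmetric chains. One fixed decomposition
-- cannot cope with sparse edges: two sets on a common chain would collide every time, so the chains
-- must be random for an edge to be charged only O(1 / n). Random maximal chains alone favour some
-- ranks over others, and the resulting LYM weights do not lead to `central n`. Drawing a maximal
-- chain and a rank interval of the symmetric chain decomposition independently gives both features
-- at once: uniform weight and rare coincidences.
--
-- The relative loss is about d (1 / r + 1 / w), which is harmless only if both parts have linear
-- size. If w is a small fraction of n, then 2 ^ w * central r is itself close to `central n`, and
-- chains in the large part suffice.
--
-- Everything stays in ℕ: averages are sums over all chains, scaled by factorials, and the real
-- exponents 1 / k of the branching bound appear as `k`th powers.

private variable
  A B : Set

∑ : List A → (A → ℕ) → ℕ
∑ xs f = sum (map f xs)

∑-cong : ∀ (xs : List A) {f g} → (∀ x → f x ≡ g x) → ∑ xs f ≡ ∑ xs g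
∑-cong xs f≗g = cong sum (map-cong f≗g xs)

∑-mono∈ : ∀ (xs : List A) {f g} → (∀ {x} → x ∈ˡ xs → f x ≤ g x) → ∑ xs f ≤ ∑ xs g
∑-mono∈ []       f≤g = z≤n
∑-mono∈ (x ∷ xs) f≤g = +-mono-≤ (f≤g (here refl)) (∑-mono∈ xs λ x∈ → f≤g (there x∈))

∑-mono : ∀ (xs : List A) {f g} → (∀ x → f x ≤ g x) → ∑ xs f ≤ ∑ xs g
∑-mono xs f≤g = ∑-mono∈ xs λ {x} _ → f≤g x

∑-zero : ∀ (xs : List A) → ∑ xs (λ _ → 0) ≡ 0
∑-zero []       = refl
∑-zero (_ ∷ xs) = ∑-zero xs

∑-const : ∀ (xs : List A) c → ∑ xs (λ _ → c) ≡ length xs * c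
∑-const []       c = refl
∑-const (_ ∷ xs) c = cong (c +_) (∑-const xs c)

∑-+ : ∀ (xs : List A) f g → ∑ xs (λ x → f x + g x) ≡ ∑ xs f + ∑ xs g
∑-+ []       f g = refl
∑-+ (x ∷ xs) f g = trans (cong (f x + g x +_) (∑-+ xs f g)) (interchange (f x) (g x) (∑ xs f) (∑ xs g))
  where
  interchange : ∀ a b c d → a + b + (c + d) ≡ a + c + (b + d)
  interchange = solve-∀

∑-*ˡ : ∀ (xs : List A) c f → ∑ xs (λ x → c * f x) ≡ c * ∑ xs f
∑-*ˡ []       c f = sym (*-zeroʳ c)
∑-*ˡ (x ∷ xs) c f = trans (cong (c * f x +_) (∑-*ˡ xs c f)) (sym (*-distribˡ-+ c (f x) (∑ xs f)))

∑-*ʳ : ∀ (xs : List A) c f → ∑ xs (λ x → f x * c) ≡ ∑ xs f * c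
∑-*ʳ xs c f = trans (∑-cong xs λ x → *-comm (f x) c) (trans (∑-*ˡ xs c f) (*-comm c _))

∑-swap : ∀ (xs : List A) (ys : List B) (f : A → B → ℕ) →
         ∑ xs (λ x → ∑ ys (f x)) ≡ ∑ ys (λ y → ∑ xs (λ x → f x y))
∑-swap []       ys f = sym (∑-zero ys)
∑-swap (x ∷ xs) ys f =
  trans (cong (∑ ys (f x) +_) (∑-swap xs ys f)) (sym (∑-+ ys (f x) _))

∑-product : ∀ (xs : List A) (ys : List B) f g →
            ∑ xs (λ x → ∑ ys (λ y → f x * g y)) ≡ ∑ xs f * ∑ ys g
∑-product xs ys f g = trans (∑-cong xs λ x → ∑-*ˡ ys (f x) g) (∑-*ʳ xs _ f)

∑-map : ∀ (h : A → B) (xs : List A) f → ∑ (map h xs) f ≡ ∑ xs (λ x → f (h x))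
∑-map h xs f = cong sum (sym (map-∘ xs))

∑-++ : ∀ (xs ys : List A) f → ∑ (xs ++ ys) f ≡ ∑ xs f + ∑ ys f
∑-++ xs ys f = trans (cong sum (map-++ f xs ys)) (sum-++ (map f xs) (map f ys))

∑-concatMap : ∀ (h : A → List B) (xs : List A) f → ∑ (concatMap h xs) f ≡ ∑ xs (λ x → ∑ (h x) f)
∑-concatMap h []       f = refl
∑-concatMap h (x ∷ xs) f = trans (∑-++ (h x) _ f) (cong (∑ (h x) f +_) (∑-concatMap h xs f))

∑-cartesianProduct : ∀ (xs : List A) (ys : List B) f →
                     ∑ (cartesianProduct xs ys) f ≡ ∑ xs (λ x → ∑ ys (λ y → f (x , y)))
∑-cartesianProduct []       ys f = refl
∑-cartesianProduct (x ∷ xs) ys f =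
  trans (∑-++ (map (x ,_) ys) _ f) (cong₂ _+_ (∑-map (x ,_) ys f) (∑-cartesianProduct xs ys f))

∑-∈ : ∀ {xs : List A} {x} f → x ∈ˡ xs → f x ≤ ∑ xs f
∑-∈ f (here refl) = m≤m+n _ _
∑-∈ f (there x∈)  = ≤-trans (∑-∈ f x∈) (m≤n+m _ _)

length≡∑1 : ∀ (xs : List A) → length xs ≡ ∑ xs (λ _ → 1)
length≡∑1 xs = sym (trans (∑-const xs 1) (*-identityʳ _))

^-distribʳ-* : ∀ k a b → (a * b) ^ k ≡ a ^ k * b ^ k
^-distribʳ-* zero    a b = refl
^-distribʳ-* (suc k) a b = trans (cong (a * b *_) (^-distribʳ-* k a b)) (lemma a b (a ^ k) (b ^ k))
  where
  lemma : ∀ a b c d → a * b * (c * d) ≡ a * c * (b * d)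
  lemma = solve-∀

-- A largest term, times the number of terms, bounds the sum, and powers respect products. This is
-- the union bound over partitions, where only `k`th powers of the terms are controlled.
∑-^-bound : ∀ k .{{_ : NonZero k}} (xs : List A) f Y → (∀ x → f x ^ k ≤ Y) →
            ∑ xs f ^ k ≤ length xs ^ k * Y
∑-^-bound (suc k) [] f Y h = z≤n
∑-^-bound {A} k (x ∷ xs) f Y h = begin
  ∑ (x ∷ xs) f ^ k                  ≤⟨ ^-monoˡ-≤ k (proj₂ (max x xs)) ⟩
  (suc (length xs) * f z) ^ k       ≡⟨ ^-distribʳ-* k (suc (length xs)) (f z) ⟩
  suc (length xs) ^ k * f z ^ k     ≤⟨ *-monoʳ-≤ (suc (length xs) ^ k) (h z) ⟩
  suc (length xs) ^ k * Y           ∎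
  where
  open ≤-Reasoning
  max : ∀ x xs → ∃ λ (z : A) → ∑ (x ∷ xs) f ≤ suc (length xs) * f z
  max x []       = x , ≤-refl
  max x (y ∷ xs) with max y xs
  ... | z , p with ≤-total (f x) (f z)
  ...   | inj₁ q = z , +-mono-≤ q p
  ...   | inj₂ q = x , +-monoʳ-≤ (f x) (≤-trans p (*-monoʳ-≤ (suc (length xs)) q))
  z = proj₁ (max x xs)

-- Symmetric chains

≤1-cases : ∀ {m} → m ≤ 1 → m ≡ 0 ⊎ m ≡ 1
≤1-cases z≤n       = inj₁ refl
≤1-cases (s≤s z≤n) = inj₂ refl

*-≤1 : ∀ {m n} → m ≤ 1 → n ≤ 1 → m * n ≤ 1
*-≤1 = *-mono-≤

*≡1 : ∀ m n → m * n ≡ 1 → m ≡ 1 × n ≡ 1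
*≡1 m n eq = m*n≡1⇒m≡1 m n eq , m*n≡1⇒n≡1 m n eq

-- Indicators take values in ℕ, so that a conjunction is a product and counting is a sum.
le : ℕ → ℕ → ℕ
le zero    _       = 1
le (suc _) zero    = 0
le (suc a) (suc b) = le a b

le≤1 : ∀ a b → le a b ≤ 1
le≤1 zero    b       = ≤-refl
le≤1 (suc a) zero    = z≤n
le≤1 (suc a) (suc b) = le≤1 a b

le⇒≤ : ∀ a b → le a b ≡ 1 → a ≤ b
le⇒≤ zero    b       eq = z≤n
le⇒≤ (suc a) (suc b) eq = s≤s (le⇒≤ a b eq)

le-yes : ∀ {a b} → a ≤ b → le a b ≡ 1
le-yes z≤n     = refl
le-yes (s≤s p) = le-yes p

le-cross : ∀ {a b} c → a < b → le c a * le b c ≡ 0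
le-cross {a}     {suc b} zero    a<b       = *-zeroʳ (le 0 a)
le-cross {zero}  {suc b} (suc c) a<b       = refl
le-cross {suc a} {suc b} (suc c) (s≤s a<b) = le-cross c a<b

∑-upTo-suc : ∀ m f → ∑ (upTo (suc m)) f ≡ f 0 + ∑ (upTo m) (f ∘ suc)
∑-upTo-suc m f = cong (λ xs → f 0 + sum xs)
  (trans (map-applyUpTo suc f m) (sym (map-applyUpTo id (f ∘ suc) m)))

∑-le-above : ∀ a f → ∑ (upTo (suc (a + f))) (le a) ≡ suc f
∑-le-above zero    f = trans (∑-const (upTo (suc f)) 1) (trans (*-identityʳ _) (length-upTo (suc f)))
∑-le-above (suc a) f = trans (∑-upTo-suc (suc (a + f)) (le (suc a))) (∑-le-above a f)

∑-le-below : ∀ {a m} → a ≤ m → ∑ (upTo (suc m)) (λ c → le c a) ≡ suc a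
∑-le-below {zero}  {m} z≤n = trans (∑-upTo-suc m (λ c → le c 0)) (cong suc (∑-zero (upTo m)))
∑-le-below {suc a} {suc m} (s≤s a≤m) = trans (∑-upTo-suc (suc m) (λ c → le c (suc a))) (cong suc (∑-le-below {a} {m} a≤m))

∑-le-below≤ : ∀ m a → ∑ (upTo m) (λ c → le c a) ≤ suc a
∑-le-below≤ zero    a       = z≤n
∑-le-below≤ (suc m) zero    = ≤-reflexive (∑-le-below {0} {m} z≤n)
∑-le-below≤ (suc m) (suc a) = ≤-trans (≤-reflexive (∑-upTo-suc m (λ c → le c (suc a)))) (s≤s (∑-le-below≤ m a))

∑-le-between : ∀ m a b e → a + e ≡ suc b → ∑ (upTo m) (λ c → le a c * le c b) ≤ e
∑-le-between zero a b e eq = z≤n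
∑-le-between m@(suc _) zero b e refl =
  ≤-trans (∑-mono (upTo m) λ c → ≤-reflexive (*-identityˡ (le c b))) (∑-le-below≤ m b)
∑-le-between (suc m) (suc a) (suc b) e eq =
  ≤-trans (≤-reflexive (∑-upTo-suc m (λ c → le (suc a) c * le c (suc b)))) (∑-le-between m a b e (suc-injective eq))
∑-le-between m@(suc _) (suc zero) zero zero eq = ≤-reflexive
  (trans (∑-cong (upTo m) λ c → trans (*-comm (le 1 c) (le c 0)) (le-cross {0} {1} c z<s)) (∑-zero (upTo m)))

-- A code p of length r describes a maximal chain of 𝒫([r]): the first entry
-- is the rank at which element 0 is inserted into the chain of 𝒫([r] ∖ {0})
-- described by the remaining entries.
codes : ∀ r → List (Vec ℕ r)
codes zero    = [] ∷ []
codes (suc r) = concatMap (λ c → map (c ∷_) (codes r)) (upTo (suc r))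

-- The chain coded by `c ∷ p` follows the smaller chain up to its member of rank `c`, adds element 0
-- to that member, and then runs through the rest with element 0 added. Hence the tail has rank at
-- most `c` if 0 is absent and at least `c` if 0 is present.
onChain : ∀ {r} → Vec ℕ r → Subset r → ℕ
onChain []      []          = 1
onChain (c ∷ p) (false ∷ A) = le ∣ A ∣ c * onChain p A
onChain (c ∷ p) (true ∷ A)  = le c ∣ A ∣ * onChain p A

onChain≤1 : ∀ {r} (p : Vec ℕ r) A → onChain p A ≤ 1
onChain≤1 []      []          = ≤-refl
onChain≤1 (c ∷ p) (false ∷ A) = *-≤1 (le≤1 ∣ A ∣ c) (onChain≤1 p A)
onChain≤1 (c ∷ p) (true ∷ A)  = *-≤1 (le≤1 c ∣ A ∣) (onChain≤1 p A)

∑-codes : ∀ r (h : ℕ → ℕ) (f : Vec ℕ r → ℕ) (g : Vec ℕ (suc r) → ℕ) → (∀ c p → g (c ∷ p) ≡ h c * f p) →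
          ∑ (codes (suc r)) g ≡ ∑ (upTo (suc r)) h * ∑ (codes r) f
∑-codes r h f g eq = begin
  ∑ (codes (suc r)) g                                       ≡⟨ ∑-concatMap (λ c → map (c ∷_) (codes r)) (upTo (suc r)) g ⟩
  ∑ (upTo (suc r)) (λ c → ∑ (map (c ∷_) (codes r)) g)       ≡⟨ ∑-cong (upTo (suc r)) (λ c → trans (∑-map (c ∷_) (codes r) g) (∑-cong (codes r) (eq c))) ⟩
  ∑ (upTo (suc r)) (λ c → ∑ (codes r) (λ p → h c * f p))    ≡⟨ ∑-product (upTo (suc r)) (codes r) h f ⟩
  ∑ (upTo (suc r)) h * ∑ (codes r) f                        ∎
  where open ≡-Reasoning

length-codes : ∀ r → length (codes r) ≡ r !
length-codes zero    = refl
length-codes (suc r) = begin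
  length (codes (suc r))                                    ≡⟨ length≡∑1 (codes (suc r)) ⟩
  ∑ (codes (suc r)) (λ _ → 1)                               ≡⟨ ∑-codes r (λ _ → 1) (λ _ → 1) (λ _ → 1) (λ _ _ → refl) ⟩
  ∑ (upTo (suc r)) (λ _ → 1) * ∑ (codes r) (λ _ → 1)        ≡⟨ cong₂ _*_ (∑-le-above 0 r) (trans (sym (length≡∑1 (codes r))) (length-codes r)) ⟩
  suc r !                                                   ∎
  where open ≡-Reasoning

-- In a maximal chain the elements of `A` come first in some order, then the `f` others. For codes:
-- an element outside `A` has as many admissible insertion ranks as there are elements outside `A`
-- from it onwards, and dually for an element inside.
onChain-count : ∀ {r} (A : Subset r) f → ∣ A ∣ + f ≡ r → ∑ (codes r) (λ p → onChain p A) ≡ ∣ A ∣ ! * f !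
onChain-count []          zero refl = refl
onChain-count {suc r} (false ∷ A) zero eq =
  contradiction (∣p∣≤n A) (<⇒≱ (≤-reflexive (sym (trans (sym (+-identityʳ ∣ A ∣)) eq))))
onChain-count {suc r} (false ∷ A) (suc f) eq = begin
  ∑ (codes (suc r)) (λ p → onChain p (false ∷ A))                ≡⟨ ∑-codes r (le ∣ A ∣) (λ p → onChain p A) _ (λ _ _ → refl) ⟩
  ∑ (upTo (suc r)) (le ∣ A ∣) * ∑ (codes r) (λ p → onChain p A)  ≡⟨ cong₂ _*_ (subst (λ m → ∑ (upTo (suc m)) (le ∣ A ∣) ≡ suc f) eq′ (∑-le-above ∣ A ∣ f)) (onChain-count A f eq′) ⟩
  suc f * (∣ A ∣ ! * f !)                                        ≡⟨ lemma (suc f) (∣ A ∣ !) (f !) ⟩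
  ∣ A ∣ ! * suc f !                                              ∎
  where
  open ≡-Reasoning
  eq′ : ∣ A ∣ + f ≡ r
  eq′ = suc-injective (trans (sym (+-suc ∣ A ∣ f)) eq)
  lemma : ∀ a b c → a * (b * c) ≡ b * (a * c)
  lemma = solve-∀
onChain-count {suc r} (true ∷ A) f eq = begin
  ∑ (codes (suc r)) (λ p → onChain p (true ∷ A))                           ≡⟨ ∑-codes r (λ c → le c ∣ A ∣) (λ p → onChain p A) _ (λ _ _ → refl) ⟩
  ∑ (upTo (suc r)) (λ c → le c ∣ A ∣) * ∑ (codes r) (λ p → onChain p A)    ≡⟨ cong₂ _*_ (∑-le-below (∣p∣≤n A)) (onChain-count A f (suc-injective eq)) ⟩
  suc ∣ A ∣ * (∣ A ∣ ! * f !)                                              ≡⟨ *-assoc (suc ∣ A ∣) (∣ A ∣ !) (f !) ⟨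
  suc ∣ A ∣ ! * f !                                                        ∎
  where open ≡-Reasoning

-- If `A ⊆ B`, a common chain orders `A`, then the `e` elements of the difference, then the `f`
-- remaining ones. Incomparable sets share no chain, so an inequality covers all pairs with these
-- sizes.
onChain-pairs : ∀ {r} (A B : Subset r) e f → ∣ A ∣ + e ≡ ∣ B ∣ → ∣ B ∣ + f ≡ r →
                ∑ (codes r) (λ p → onChain p A * onChain p B) ≤ ∣ A ∣ ! * (e ! * f !)
onChain-pairs [] [] zero zero refl refl = ≤-refl
onChain-pairs {suc r} (x ∷ A) (y ∷ B) e f eqA eqB = main x y e f eqA eqB
  where
  open ≤-Reasoning
  four : ∀ a b c d → a * b * (c * d) ≡ a * c * (b * d)
  four = solve-∀
  bound : ∀ h h′ {H K} → ∑ (upTo (suc r)) (λ c → h c * h′ c) ≤ H →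
          ∑ (codes r) (λ p → onChain p A * onChain p B) ≤ K →
          ∑ (codes (suc r)) (λ { (c ∷ p) → (h c * onChain p A) * (h′ c * onChain p B) }) ≤ H * K
  bound h h′ {H} {K} u v = ≤-trans
    (≤-reflexive (∑-codes r (λ c → h c * h′ c) (λ p → onChain p A * onChain p B) _
      (λ c p → four (h c) (onChain p A) (h′ c) (onChain p B))))
    (*-mono-≤ u v)
  pointwise : ∀ {g g′ : Vec ℕ (suc r) → ℕ} {m} → (∀ c p → g (c ∷ p) ≡ g′ (c ∷ p)) → ∑ (codes (suc r)) g′ ≤ m → ∑ (codes (suc r)) g ≤ m
  pointwise eq le = ≤-trans (≤-reflexive (∑-cong (codes (suc r)) λ { (c ∷ p) → eq c p })) le
  main : ∀ x y e f → ∣ x ∷ A ∣ + e ≡ ∣ y ∷ B ∣ → ∣ y ∷ B ∣ + f ≡ suc r →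
         ∑ (codes (suc r)) (λ p → onChain p (x ∷ A) * onChain p (y ∷ B)) ≤ ∣ x ∷ A ∣ ! * (e ! * f !)
  main false false e zero eqA eqB =
    contradiction (∣p∣≤n B) (<⇒≱ (≤-reflexive (sym (trans (sym (+-identityʳ ∣ B ∣)) eqB))))
  main false false e (suc f) eqA eqB = pointwise (λ _ _ → refl) (begin
    _ ≤⟨ bound (le ∣ A ∣) (le ∣ B ∣) {suc f}
           (≤-trans (∑-mono (upTo (suc r)) λ c → *-monoˡ-≤ (le ∣ B ∣ c) (le≤1 ∣ A ∣ c))
             (≤-reflexive (trans (∑-cong (upTo (suc r)) λ c → *-identityˡ (le ∣ B ∣ c))
               (subst (λ m → ∑ (upTo (suc m)) (le ∣ B ∣) ≡ suc f) eq′ (∑-le-above ∣ B ∣ f)))))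
           (onChain-pairs A B e f eqA eq′) ⟩
    suc f * (∣ A ∣ ! * (e ! * f !)) ≡⟨ lemma (suc f) (∣ A ∣ !) (e !) (f !) ⟩
    ∣ A ∣ ! * (e ! * suc f !)       ∎)
    where
    eq′ : ∣ B ∣ + f ≡ r
    eq′ = suc-injective (trans (sym (+-suc ∣ B ∣ f)) eqB)
    lemma : ∀ a b c d → a * (b * (c * d)) ≡ b * (c * (a * d))
    lemma = solve-∀
  main true true e f eqA eqB = pointwise (λ _ _ → refl) (begin
    _ ≤⟨ bound (λ c → le c ∣ A ∣) (λ c → le c ∣ B ∣) {suc ∣ A ∣}
           (≤-trans (∑-mono (upTo (suc r)) λ c → *-monoʳ-≤ (le c ∣ A ∣) (le≤1 c ∣ B ∣))
             (≤-reflexive (trans (∑-cong (upTo (suc r)) λ c → *-identityʳ (le c ∣ A ∣))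
               (∑-le-below (∣p∣≤n A)))))
           (onChain-pairs A B e f (suc-injective eqA) (suc-injective eqB)) ⟩
    suc ∣ A ∣ * (∣ A ∣ ! * (e ! * f !)) ≡⟨ *-assoc (suc ∣ A ∣) (∣ A ∣ !) _ ⟨
    suc ∣ A ∣ ! * (e ! * f !)           ∎)
  -- The tail `A` has one element more than the tail `B`, so no insertion rank lies between their
  -- sizes.
  main false true zero f eqA eqB = pointwise (λ _ _ → refl) (≤-trans
    (bound (le ∣ A ∣) (λ c → le c ∣ B ∣) {0} (∑-le-between (suc r) ∣ A ∣ ∣ B ∣ 0 eqA) ≤-refl) z≤n)
  main false true (suc e) f eqA eqB = pointwise (λ _ _ → refl) (begin
    _ ≤⟨ bound (le ∣ A ∣) (λ c → le c ∣ B ∣) {suc e} (∑-le-between (suc r) ∣ A ∣ ∣ B ∣ (suc e) eqA)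
           (onChain-pairs A B e f (suc-injective (trans (sym (+-suc ∣ A ∣ e)) eqA)) (suc-injective eqB)) ⟩
    suc e * (∣ A ∣ ! * (e ! * f !)) ≡⟨ lemma (suc e) (∣ A ∣ !) (e !) (f !) ⟩
    ∣ A ∣ ! * (suc e ! * f !)       ∎)
    where
    lemma : ∀ a b c d → a * (b * (c * d)) ≡ b * (a * c * d)
    lemma = solve-∀
  main true false e f eqA eqB = pointwise (λ _ _ → refl) (≤-trans
    (bound (λ c → le c ∣ A ∣) (le ∣ B ∣) {0}
      (≤-reflexive (trans (∑-cong (upTo (suc r)) λ c → le-cross c (≤-trans (m≤m+n (suc ∣ A ∣) e) (≤-reflexive eqA))) (∑-zero (upTo (suc r))))) ≤-refl) z≤n)

onChain-⊆ : ∀ {r} (p : Vec ℕ r) A B → onChain p A ≡ 1 → onChain p B ≡ 1 → ∣ A ∣ ≤ ∣ B ∣ → A ⊆ B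
onChain-⊆ []      []          []          a b A≤B = ⊆-refl
onChain-⊆ (c ∷ p) (false ∷ A) (false ∷ B) a b A≤B =
  out⊆ (onChain-⊆ p A B (proj₂ (*≡1 (le ∣ A ∣ c) _ a)) (proj₂ (*≡1 (le ∣ B ∣ c) _ b)) A≤B)
onChain-⊆ (c ∷ p) (true ∷ A)  (true ∷ B)  a b A≤B =
  in⊆in (onChain-⊆ p A B (proj₂ (*≡1 (le c ∣ A ∣) _ a)) (proj₂ (*≡1 (le c ∣ B ∣) _ b)) (s≤s⁻¹ A≤B))
onChain-⊆ (c ∷ p) (false ∷ A) (true ∷ B)  a b _ with *≡1 (le ∣ A ∣ c) _ a | *≡1 (le c ∣ B ∣) _ b
... | h , a′ | h′ , b′ = out⊆ (onChain-⊆ p A B a′ b′ (≤-trans (le⇒≤ ∣ A ∣ c h) (le⇒≤ c ∣ B ∣ h′)))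
onChain-⊆ (c ∷ p) (true ∷ A)  (false ∷ B) a b A≤B with *≡1 (le c ∣ A ∣) _ a | *≡1 (le ∣ B ∣ c) _ b
... | h , _ | h′ , _ = ⊥-elim (<-irrefl refl (≤-trans A≤B (≤-trans (le⇒≤ ∣ B ∣ c h′) (le⇒≤ c ∣ A ∣ h))))

-- The recursion of de Bruijn, Tengbergen and Kruyswijk: a symmetric chain is prolonged by its top
-- with the new element added, and its other members with the new element added form a second chain,
-- which is absent if the chain was a single set. Only the ranks are recorded, since the sets
-- themselves come from an independent maximal chain.
splitInterval : ℕ × ℕ → List (ℕ × ℕ)
splitInterval (α , zero)  = (α , 1) ∷ []
splitInterval (α , suc ℓ) = (α , suc (suc ℓ)) ∷ (suc α , ℓ) ∷ []

-- (α , ℓ) stands for the interval of ranks α, …, α + ℓ.  The list contains the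
-- rank intervals of the chains in the symmetric chain decomposition of 𝒫([r]).
intervals : ℕ → List (ℕ × ℕ)
intervals zero    = (0 , 0) ∷ []
intervals (suc r) = concatMap splitInterval (intervals r)

inInterval : ℕ × ℕ → ℕ → ℕ
inInterval (zero  , ℓ) i       = le i ℓ
inInterval (suc α , ℓ) zero    = 0
inInterval (suc α , ℓ) (suc i) = inInterval (α , ℓ) i

inInterval≤1 : ∀ α ℓ i → inInterval (α , ℓ) i ≤ 1
inInterval≤1 zero    ℓ i       = le≤1 i ℓ
inInterval≤1 (suc α) ℓ zero    = z≤n
inInterval≤1 (suc α) ℓ (suc i) = inInterval≤1 α ℓ i

inInterval⇒ : ∀ α ℓ i → inInterval (α , ℓ) i ≡ 1 → ∃ λ t → t ≤ ℓ × i ≡ α + t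
inInterval⇒ zero    ℓ i       eq = i , le⇒≤ i ℓ eq , refl
inInterval⇒ (suc α) ℓ (suc i) eq with inInterval⇒ α ℓ i eq
... | t , t≤ℓ , refl = t , t≤ℓ , refl

inInterval-step₀ : ∀ I → ∑ (splitInterval I) (λ J → inInterval J 0) ≡ inInterval I 0
inInterval-step₀ (zero  , zero)  = refl
inInterval-step₀ (zero  , suc ℓ) = refl
inInterval-step₀ (suc α , zero)  = refl
inInterval-step₀ (suc α , suc ℓ) = refl

-- A member of rank `suc i` in the split chains either gains the new element, from rank `i`, or does
-- not, from rank `suc i`. Summed over all intervals this becomes Pascal's rule.
inInterval-step : ∀ I i → ∑ (splitInterval I) (λ J → inInterval J (suc i)) ≡ inInterval I i + inInterval I (suc i)
inInterval-step (zero , zero)  zero    = refl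
inInterval-step (zero , zero)  (suc i) = refl
inInterval-step (zero , suc ℓ) i       = cong (le i (suc ℓ) +_) (+-identityʳ (le i ℓ))
inInterval-step (suc zero , zero)     zero = refl
inInterval-step (suc (suc α) , zero)  zero = refl
inInterval-step (suc zero , suc ℓ)    zero = refl
inInterval-step (suc (suc α) , suc ℓ) zero = refl
inInterval-step (suc α , zero)  (suc i) = inInterval-step (α , zero) i
inInterval-step (suc α , suc ℓ) (suc i) = inInterval-step (α , suc ℓ) i

intervals-count : ∀ r i → ∑ (intervals r) (λ I → inInterval I i) ≡ r C i
intervals-count zero    zero    = refl
intervals-count zero    (suc i) = refl
intervals-count (suc r) zero    = trans (∑-concatMap (splitInterval) (intervals r) _)
  (trans (∑-cong (intervals r) inInterval-step₀) (intervals-count r 0))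
intervals-count (suc r) (suc i) = begin
  ∑ (intervals (suc r)) (λ I → inInterval I (suc i))                   ≡⟨ ∑-concatMap (splitInterval) (intervals r) _ ⟩
  ∑ (intervals r) (λ I → ∑ (splitInterval I) (λ J → inInterval J (suc i))) ≡⟨ ∑-cong (intervals r) (λ I → inInterval-step I i) ⟩
  ∑ (intervals r) (λ I → inInterval I i + inInterval I (suc i))        ≡⟨ ∑-+ (intervals r) _ _ ⟩
  _                                                                    ≡⟨ cong₂ _+_ (intervals-count r i) (intervals-count r (suc i)) ⟩
  r C i + r C suc i                                                    ≡⟨ nCk+nC[k+1]≡[n+1]C[k+1] r i ⟩
  suc r C suc i                                                        ∎
  where open ≡-Reasoning

C-factorial : ∀ a f → ((a + f) C a) * (a ! * f !) ≡ (a + f) !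
C-factorial a f = begin
  ((a + f) C a) * (a ! * f !)                                      ≡⟨ cong (λ m → ((a + f) C a) * (a ! * m !)) (m+n∸m≡n a f) ⟨
  ((a + f) C a) * (a ! * (a + f ∸ a) !)                            ≡⟨ cong (_* (a ! * (a + f ∸ a) !)) (nCk≡n!/k![n-k]! (m≤m+n a f)) ⟩
  ((a + f) ! / (a ! * (a + f ∸ a) !)) * (a ! * (a + f ∸ a) !)    ≡⟨ m/n*n≡m (k![n∸k]!∣n! (m≤m+n a f)) ⟩
  (a + f) !                                                      ∎
  where
  open ≡-Reasoning
  instance _ = a !* (a + f ∸ a) !≢0

Chain : ℕ → Set
Chain r = Vec ℕ r × (ℕ × ℕ)

chains : ∀ r → List (Chain r)
chains r = cartesianProduct (codes r) (intervals r)

inChain : ∀ {r} → Chain r → Subset r → ℕ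
inChain (p , I) A = onChain p A * inInterval I ∣ A ∣

inChain≤1 : ∀ {r} (s : Chain r) A → inChain s A ≤ 1
inChain≤1 (p , α , ℓ) A = *-≤1 (onChain≤1 p A) (inInterval≤1 α ℓ ∣ A ∣)

-- Maximal chains favour ranks with few sets, intervals favour ranks with many, and the two effects
-- cancel exactly: `∣ A ∣ ! * (r ∸ ∣ A ∣) !` codes times `r C ∣ A ∣` intervals. This makes the later
-- averages count members rather than weigh them.
chains-cover : ∀ {r} (A : Subset r) → ∑ (chains r) (λ s → inChain s A) ≡ r !
chains-cover {r} A = begin
  ∑ (chains r) (λ s → inChain s A)                                                   ≡⟨ ∑-cartesianProduct (codes r) (intervals r) _ ⟩
  ∑ (codes r) (λ p → ∑ (intervals r) (λ I → onChain p A * inInterval I ∣ A ∣))       ≡⟨ ∑-product (codes r) (intervals r) _ _ ⟩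
  ∑ (codes r) (λ p → onChain p A) * ∑ (intervals r) (λ I → inInterval I ∣ A ∣)       ≡⟨ cong₂ _*_ (onChain-count A (r ∸ ∣ A ∣) r≡) (intervals-count r ∣ A ∣) ⟩
  ∣ A ∣ ! * (r ∸ ∣ A ∣) ! * (r C ∣ A ∣)                                              ≡⟨ *-comm (∣ A ∣ ! * (r ∸ ∣ A ∣) !) (r C ∣ A ∣) ⟩
  (r C ∣ A ∣) * (∣ A ∣ ! * (r ∸ ∣ A ∣) !)                                            ≡⟨ cong (λ m → (m C ∣ A ∣) * (∣ A ∣ ! * (r ∸ ∣ A ∣) !)) r≡ ⟨
  ((∣ A ∣ + (r ∸ ∣ A ∣)) C ∣ A ∣) * (∣ A ∣ ! * (r ∸ ∣ A ∣) !)                        ≡⟨ C-factorial ∣ A ∣ (r ∸ ∣ A ∣) ⟩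
  (∣ A ∣ + (r ∸ ∣ A ∣)) !                                                            ≡⟨ cong _! r≡ ⟩
  r !                                                                                ∎
  where
  open ≡-Reasoning
  r≡ : ∣ A ∣ + (r ∸ ∣ A ∣) ≡ r
  r≡ = m+[n∸m]≡n (∣p∣≤n A)

!-product≤ : ∀ e f → suc e ! * suc f ! ≤ suc (e + f) !
!-product≤ e zero    = ≤-reflexive (trans (*-identityʳ (suc e !)) (cong (λ m → suc m !) (sym (+-identityʳ e))))
!-product≤ e (suc f) = begin
  suc e ! * (suc (suc f) * suc f !)     ≡⟨ lemma (suc e !) (suc (suc f)) (suc f !) ⟩
  suc (suc f) * (suc e ! * suc f !)     ≤⟨ *-mono-≤ (s≤s (m≤n+m (suc f) e)) (!-product≤ e f) ⟩
  suc (e + suc f) * suc (e + f) !       ≡⟨ cong (λ m → suc (e + suc f) * m !) (+-suc e f) ⟨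
  suc (e + suc f) !                     ∎
  where
  open ≤-Reasoning
  lemma : ∀ a b c → a * (b * c) ≡ b * (a * c)
  lemma = solve-∀

-- In other words, a binomial coefficient of `e + f` is at least `e + f` away from the two ends of
-- its row. This is the source of the factor O(1 / n) per edge.
!-product*+≤ : ∀ {e f} → 1 ≤ e → 1 ≤ f → (e ! * f !) * (e + f) ≤ (e + f) !
!-product*+≤ {suc e} {suc f} _ _ = begin
  suc e ! * suc f ! * (suc e + suc f)       ≤⟨ *-monoˡ-≤ (suc e + suc f) (!-product≤ e f) ⟩
  suc (e + f) ! * (suc e + suc f)           ≡⟨ *-comm (suc (e + f) !) (suc e + suc f) ⟩
  (suc e + suc f) * suc (e + f) !           ≡⟨ cong (λ m → (suc e + suc f) * m !) (+-suc e f) ⟨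
  (suc e + suc f) !                         ∎
  where open ≤-Reasoning

∑-pairs : ∀ {r} → Subset r → Subset r → ℕ
∑-pairs {r} A B = ∑ (chains r) (λ s → inChain s A * inChain s B)

∑-pairs-comm : ∀ {r} (A B : Subset r) → ∑-pairs A B ≡ ∑-pairs B A
∑-pairs-comm {r} A B = ∑-cong (chains r) λ s → *-comm (inChain s A) (inChain s B)

∑-pairs≤! : ∀ {r} (A B : Subset r) → ∑-pairs A B ≤ r !
∑-pairs≤! {r} A B = ≤-trans
  (∑-mono (chains r) λ s → ≤-trans (*-monoʳ-≤ (inChain s A) (inChain≤1 s B)) (≤-reflexive (*-identityʳ _)))
  (≤-reflexive (chains-cover A))

onChain-same-size : ∀ {r} (p : Vec ℕ r) {A B} → onChain p A ≡ 1 → onChain p B ≡ 1 → ∣ A ∣ ≡ ∣ B ∣ → A ≡ B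
onChain-same-size p {A} {B} a b eq =
  ⊆-antisym (onChain-⊆ p A B a b (≤-reflexive eq)) (onChain-⊆ p B A b a (≤-reflexive (sym eq)))

-- The empty set has to be excluded: ∅ and [r] lie together on every chain of full length.
∑-pairs-bound : ∀ {r} (A B : Subset r) → A ≢ B → 1 ≤ ∣ A ∣ → 1 ≤ ∣ B ∣ → r * ∑-pairs A B ≤ 2 * r !
∑-pairs-bound {r} A B A≢B 1≤A 1≤B =
  [ ordered A B A≢B 1≤A
  , (λ B≤A → subst (λ m → r * m ≤ 2 * r !) (∑-pairs-comm B A) (ordered B A (λ eq → A≢B (sym eq)) 1≤B B≤A))
  ]′ (≤-total ∣ A ∣ ∣ B ∣)
  where
  open ≤-Reasoning
  ordered : ∀ A B → A ≢ B → 1 ≤ ∣ A ∣ → ∣ A ∣ ≤ ∣ B ∣ → r * ∑-pairs A B ≤ 2 * r !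
  ordered A B A≢B 1≤A A≤B = subst (λ m → r * m ≤ 2 * r !) (sym split)
    ([ main , (λ e<1 → subst (λ m → r * (m * Y) ≤ 2 * r !) (sym (X≡0 (n<1⇒n≡0 e<1))) (≤-trans (≤-reflexive (*-zeroʳ r)) z≤n)) ]′
      (≤-<-connex 1 e))
    where
    a = ∣ A ∣
    e = ∣ B ∣ ∸ ∣ A ∣
    f = r ∸ ∣ B ∣
    X = ∑ (codes r) (λ p → onChain p A * onChain p B)
    Y = ∑ (intervals r) (λ I → inInterval I ∣ A ∣ * inInterval I ∣ B ∣)
    ae≡ : a + e ≡ ∣ B ∣
    ae≡ = m+[n∸m]≡n A≤B
    Bf≡ : ∣ B ∣ + f ≡ r
    Bf≡ = m+[n∸m]≡n (∣p∣≤n B)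
    r≡ : r ≡ a + e + f
    r≡ = sym (trans (cong (_+ f) ae≡) Bf≡)
    four : ∀ a b c d → a * b * (c * d) ≡ a * c * (b * d)
    four = solve-∀
    split : ∑-pairs A B ≡ X * Y
    split = trans (∑-cartesianProduct (codes r) (intervals r) _)
      (trans (∑-cong (codes r) λ p → ∑-cong (intervals r) λ I → four (onChain p A) (inInterval I ∣ A ∣) (onChain p B) (inInterval I ∣ B ∣))
        (∑-product (codes r) (intervals r) (λ p → onChain p A * onChain p B) _))
    X≤ : X ≤ a ! * (e ! * f !)
    X≤ = onChain-pairs A B e f ae≡ Bf≡
    Y≤A : Y ≤ (a + e + f) C a
    Y≤A = ≤-trans (∑-mono (intervals r) λ { (α , ℓ) → ≤-trans (*-monoʳ-≤ (inInterval (α , ℓ) ∣ A ∣) (inInterval≤1 α ℓ ∣ B ∣)) (≤-reflexive (*-identityʳ _)) })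
      (≤-reflexive (trans (intervals-count r a) (cong (_C a) r≡)))
    Y≤B : Y ≤ (a + e + f) C (a + e)
    Y≤B = ≤-trans (∑-mono (intervals r) λ { (α , ℓ) → ≤-trans (*-monoˡ-≤ (inInterval (α , ℓ) ∣ B ∣) (inInterval≤1 α ℓ ∣ A ∣)) (≤-reflexive (*-identityˡ _)) })
      (≤-reflexive (trans (intervals-count r ∣ B ∣) (cong₂ _C_ r≡ (sym ae≡))))
    -- Distinct sets of equal size never share a chain.
    X≡0 : e ≡ 0 → X ≡ 0
    X≡0 e≡0 = trans (∑-cong (codes r) λ p → [ id , (λ one → ⊥-elim (A≢B (onChain-same-size p
            (proj₁ (*≡1 (onChain p A) _ one)) (proj₂ (*≡1 (onChain p A) _ one))
            (trans (sym (+-identityʳ a)) (trans (cong (a +_) (sym e≡0)) ae≡))))) ]′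
            (≤1-cases (*-≤1 (onChain≤1 p A) (onChain≤1 p B)))) (∑-zero (codes r))
    -- The factor `r` is split as `(a + e) + f`. The first share is paid with the intervals through
    -- the rank of `B`, the second with those through the rank of `A`; each costs at most `r !`,
    -- whence the factor 2.
    main : 1 ≤ e → r * (X * Y) ≤ 2 * r !
    main 1≤e = begin
      r * (X * Y)                       ≡⟨ cong (_* (X * Y)) r≡ ⟩
      (a + e + f) * (X * Y)             ≡⟨ *-distribʳ-+ (X * Y) (a + e) f ⟩
      (a + e) * (X * Y) + f * (X * Y)   ≤⟨ +-mono-≤ lower (upper f refl) ⟩
      r ! + r !                         ≡⟨ cong (r ! +_) (+-identityʳ (r !)) ⟨
      2 * r !                           ∎
      where
      lower : (a + e) * (X * Y) ≤ r !
      lower = begin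
        (a + e) * (X * Y)                                              ≤⟨ *-monoʳ-≤ (a + e) (*-mono-≤ X≤ Y≤B) ⟩
        (a + e) * (a ! * (e ! * f !) * ((a + e + f) C (a + e)))        ≡⟨ lemma (a + e) (a !) (e !) (f !) _ ⟩
        ((a + e + f) C (a + e)) * (a ! * e ! * (a + e) * f !)          ≤⟨ *-monoʳ-≤ ((a + e + f) C (a + e)) (*-monoˡ-≤ (f !) (!-product*+≤ 1≤A 1≤e)) ⟩
        ((a + e + f) C (a + e)) * ((a + e) ! * f !)                    ≡⟨ C-factorial (a + e) f ⟩
        (a + e + f) !                                                  ≡⟨ cong _! r≡ ⟨
        r !                                                            ∎
        where
        lemma : ∀ n a b c d → n * (a * (b * c) * d) ≡ d * (a * b * n * c)
        lemma = solve-∀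
      -- The copy `f′` permits a case split on the difference `f`; the factorial estimate requires
      -- `f` to be positive.
      upper : ∀ f′ → f′ ≡ f → f′ * (X * Y) ≤ r !
      upper zero     eq = z≤n
      upper (suc f′) eq = begin
        suc f′ * (X * Y)                                             ≡⟨ cong (_* (X * Y)) eq ⟩
        f * (X * Y)                                                  ≤⟨ *-monoˡ-≤ (X * Y) (m≤n+m f e) ⟩
        (e + f) * (X * Y)                                            ≤⟨ *-monoʳ-≤ (e + f) (*-mono-≤ X≤ Y≤A) ⟩
        (e + f) * (a ! * (e ! * f !) * ((a + e + f) C a))            ≡⟨ lemma (e + f) (a !) (e ! * f !) _ ⟩
        ((a + e + f) C a) * (a ! * (e ! * f ! * (e + f)))            ≤⟨ *-monoʳ-≤ ((a + e + f) C a) (*-monoʳ-≤ (a !) (!-product*+≤ 1≤e (subst (1 ≤_) eq z<s))) ⟩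
        ((a + e + f) C a) * (a ! * (e + f) !)                        ≡⟨ cong (λ m → (m C a) * (a ! * (e + f) !)) (+-assoc a e f) ⟩
        ((a + (e + f)) C a) * (a ! * (e + f) !)                      ≡⟨ C-factorial a (e + f) ⟩
        (a + (e + f)) !                                              ≡⟨ cong _! (trans r≡ (+-assoc a e f)) ⟨
        r !                                                          ∎
        where
        lemma : ∀ n a b d → n * (a * b * d) ≡ d * (a * (b * n))
        lemma = solve-∀

-- Binomial coefficients

-- The Cauchy product, with the first argument shifted along instead of subtracting the index from
-- `m`.
conv : (ℕ → ℕ) → (ℕ → ℕ) → ℕ → ℕ
conv f g zero    = f 0 * g 0
conv f g (suc m) = f 0 * g (suc m) + conv (f ∘ suc) g m

conv-congˡ : ∀ {f f′} g m → (∀ i → f i ≡ f′ i) → conv f g m ≡ conv f′ g m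
conv-congˡ g zero    eq = cong (_* g 0) (eq 0)
conv-congˡ g (suc m) eq = cong₂ _+_ (cong (_* g (suc m)) (eq 0)) (conv-congˡ g m (eq ∘ suc))

conv-+ˡ : ∀ f f′ g m → conv (λ i → f i + f′ i) g m ≡ conv f g m + conv f′ g m
conv-+ˡ f f′ g zero    = *-distribʳ-+ (g 0) (f 0) (f′ 0)
conv-+ˡ f f′ g (suc m) =
  trans (cong ((f 0 + f′ 0) * g (suc m) +_) (conv-+ˡ (f ∘ suc) (f′ ∘ suc) g m)) (lemma (f 0) (f′ 0) (g (suc m)) _ _)
  where
  lemma : ∀ a b c d e → (a + b) * c + (d + e) ≡ a * c + d + (b * c + e)
  lemma = solve-∀

conv-zeroˡ : ∀ g m → conv (λ _ → 0) g m ≡ 0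
conv-zeroˡ g zero    = refl
conv-zeroˡ g (suc m) = conv-zeroˡ g m

conv-sucʳ : ∀ f g m → conv f g (suc m) ≡ f (suc m) * g 0 + conv f (g ∘ suc) m
conv-sucʳ f g zero    = +-comm (f 0 * g 1) (f 1 * g 0)
conv-sucʳ f g (suc m) = trans (cong (f 0 * g (suc (suc m)) +_) (conv-sucʳ (f ∘ suc) g m)) (lemma (f 0 * g (suc (suc m))) (f (suc (suc m)) * g 0) _)
  where
  lemma : ∀ a b c → a + (b + c) ≡ b + (a + c)
  lemma = solve-∀

conv-comm : ∀ f g m → conv f g m ≡ conv g f m
conv-comm f g zero    = *-comm (f 0) (g 0)
conv-comm f g (suc m) = trans (conv-sucʳ f g m) (cong₂ _+_ (*-comm (f (suc m)) (g 0)) (conv-comm f (g ∘ suc) m))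

conv-∑ˡ : ∀ {A : Set} (xs : List A) (f : A → ℕ → ℕ) g m →
          ∑ xs (λ x → conv (f x) g m) ≡ conv (λ i → ∑ xs (λ x → f x i)) g m
conv-∑ˡ []       f g m = sym (conv-zeroˡ g m)
conv-∑ˡ (x ∷ xs) f g m = trans (cong (conv (f x) g m +_) (conv-∑ˡ xs f g m)) (sym (conv-+ˡ (f x) _ g m))

conv-∑ : ∀ {A B : Set} (xs : List A) (ys : List B) (f : A → ℕ → ℕ) (g : B → ℕ → ℕ) m →
         ∑ xs (λ x → ∑ ys (λ y → conv (f x) (g y) m)) ≡
         conv (λ i → ∑ xs (λ x → f x i)) (λ i → ∑ ys (λ y → g y i)) m
conv-∑ xs ys f g m = begin
  ∑ xs (λ x → ∑ ys (λ y → conv (f x) (g y) m))                              ≡⟨ ∑-cong xs (λ x → ∑-cong ys λ y → conv-comm (f x) (g y) m) ⟩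
  ∑ xs (λ x → ∑ ys (λ y → conv (g y) (f x) m))                              ≡⟨ ∑-cong xs (λ x → conv-∑ˡ ys g (f x) m) ⟩
  ∑ xs (λ x → conv (λ i → ∑ ys (λ y → g y i)) (f x) m)                      ≡⟨ ∑-cong xs (λ x → conv-comm _ (f x) m) ⟩
  ∑ xs (λ x → conv (f x) (λ i → ∑ ys (λ y → g y i)) m)                      ≡⟨ conv-∑ˡ xs f _ m ⟩
  conv (λ i → ∑ xs (λ x → f x i)) (λ i → ∑ ys (λ y → g y i)) m              ∎
  where open ≡-Reasoning

vandermonde : ∀ r w m → conv (r C_) (w C_) m ≡ (r + w) C m
vandermonde zero w zero    = *-identityˡ (w C 0)
vandermonde zero w (suc m) =
  trans (cong₂ _+_ (*-identityˡ (w C suc m)) (conv-zeroˡ (w C_) m)) (+-identityʳ (w C suc m))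
vandermonde (suc r) w zero = refl
vandermonde (suc r) w (suc m) = begin
  (suc r C 0) * (w C suc m) + conv (λ i → suc r C suc i) (w C_) m      ≡⟨ cong ((r C 0) * (w C suc m) +_)
                                                                           (conv-congˡ (w C_) m λ i → sym (nCk+nC[k+1]≡[n+1]C[k+1] r i)) ⟩
  (r C 0) * (w C suc m) + conv (λ i → r C i + r C suc i) (w C_) m      ≡⟨ cong ((r C 0) * (w C suc m) +_) (conv-+ˡ (r C_) _ (w C_) m) ⟩
  (r C 0) * (w C suc m) + (conv (r C_) (w C_) m + conv (λ i → r C suc i) (w C_) m)  ≡⟨ lemma ((r C 0) * (w C suc m)) (conv (r C_) (w C_) m) _ ⟩
  conv (r C_) (w C_) m + conv (r C_) (w C_) (suc m)                    ≡⟨ cong₂ _+_ (vandermonde r w m) (vandermonde r w (suc m)) ⟩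
  (r + w) C m + (r + w) C suc m                                        ≡⟨ nCk+nC[k+1]≡[n+1]C[k+1] (r + w) m ⟩
  suc (r + w) C suc m                                                  ∎
  where
  open ≡-Reasoning
  lemma : ∀ a b c → a + (b + c) ≡ b + (a + c)
  lemma = solve-∀

intervals-symmetric : ∀ r {I} → I ∈ˡ intervals r → proj₁ I + proj₂ I + proj₁ I ≡ r
intervals-symmetric zero    (here refl) = refl
intervals-symmetric (suc r) I∈ with find (∈-concatMap⁻ splitInterval {xs = intervals r} I∈)
... | (α , zero)  , J∈ , here refl         = trans (lemma α) (cong suc (intervals-symmetric r J∈))
  where
  lemma : ∀ a → a + 1 + a ≡ suc (a + 0 + a)
  lemma = solve-∀
... | (α , suc ℓ) , J∈ , here refl         = trans (lemma α ℓ) (cong suc (intervals-symmetric r J∈))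
  where
  lemma : ∀ a l → a + suc (suc l) + a ≡ suc (a + suc l + a)
  lemma = solve-∀
... | (α , suc ℓ) , J∈ , there (here refl) = trans (lemma α ℓ) (cong suc (intervals-symmetric r J∈))
  where
  lemma : ∀ a l → suc a + l + suc a ≡ suc (a + suc l + a)
  lemma = solve-∀

⌊a+b+a/2⌋ : ∀ a b → ⌊ a + b + a /2⌋ ≡ a + ⌊ b /2⌋
⌊a+b+a/2⌋ zero    b = cong ⌊_/2⌋ (+-identityʳ b)
⌊a+b+a/2⌋ (suc a) b = trans (cong (λ m → ⌊ suc m /2⌋) (+-suc (a + b) a)) (cong suc (⌊a+b+a/2⌋ a b))

conv-le : ∀ ℓ ℓ′ m → ℓ ≤ m → m ≤ ℓ′ → suc ℓ ≤ conv (λ i → le i ℓ) (λ i → le i ℓ′) m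
conv-le zero    ℓ′ zero    _ _   = ≤-refl
conv-le zero    ℓ′ (suc m) _ m<ℓ′ =
  ≤-trans (≤-reflexive (sym (trans (*-identityˡ _) (le-yes m<ℓ′)))) (m≤m+n _ _)
conv-le (suc ℓ) ℓ′ (suc m) (s≤s ℓ≤m) m<ℓ′ =
  +-mono-≤ (≤-reflexive (sym (trans (*-identityˡ _) (le-yes m<ℓ′)))) (conv-le ℓ ℓ′ m ℓ≤m (<⇒≤ m<ℓ′))

⌊/2⌋-between : ∀ {a b} → a ≤ b → a ≤ ⌊ a + b /2⌋ × ⌊ a + b /2⌋ ≤ b
⌊/2⌋-between {a} {b} a≤b =
  ≤-trans (≤-reflexive (n≡⌊n+n/2⌋ a)) (⌊n/2⌋-mono (+-monoʳ-≤ a a≤b)) ,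
  ≤-trans (⌊n/2⌋-mono (+-monoˡ-≤ b a≤b)) (≤-reflexive (sym (n≡⌊n+n/2⌋ b)))

-- The middle antidiagonal meets a grid of rank intervals in as many points as its shorter side has.
conv-inInterval : ∀ α ℓ β ℓ′ →
  suc (ℓ ⊓ ℓ′) ≤ conv (inInterval (α , ℓ)) (inInterval (β , ℓ′)) (α + (β + ⌊ ℓ + ℓ′ /2⌋))
conv-inInterval (suc α) ℓ β ℓ′ = conv-inInterval α ℓ β ℓ′
conv-inInterval zero ℓ (suc β) ℓ′ = ≤-trans (conv-inInterval zero ℓ β ℓ′)
  (≤-trans (m≤n+m _ _) (≤-reflexive (sym (conv-sucʳ (λ i → le i ℓ) (inInterval (suc β , ℓ′)) _))))
conv-inInterval zero ℓ zero ℓ′ with ≤-total ℓ ℓ′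
... | inj₁ ℓ≤ℓ′ rewrite m≤n⇒m⊓n≡m ℓ≤ℓ′ =
  conv-le ℓ ℓ′ ⌊ ℓ + ℓ′ /2⌋ (proj₁ (⌊/2⌋-between ℓ≤ℓ′)) (proj₂ (⌊/2⌋-between ℓ≤ℓ′))
... | inj₂ ℓ′≤ℓ rewrite m≥n⇒m⊓n≡n ℓ′≤ℓ | +-comm ℓ ℓ′ | conv-comm (λ i → le i ℓ) (λ i → le i ℓ′) ⌊ ℓ′ + ℓ /2⌋ =
  conv-le ℓ′ ℓ ⌊ ℓ′ + ℓ /2⌋ (proj₁ (⌊/2⌋-between ℓ′≤ℓ)) (proj₂ (⌊/2⌋-between ℓ′≤ℓ))

central : ℕ → ℕ
central n = n C ⌊ n /2⌋

-- Because the intervals are symmetric, the middle antidiagonals of all grids lie on the single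
-- level `⌊ r + w /2⌋`. Each shorter side is thus a number of grid points on that level, and
-- Vandermonde's identity adds them up.
∑-intervals-⊓ : ∀ r w → ∑ (intervals r) (λ I → ∑ (intervals w) (λ J → suc (proj₂ I ⊓ proj₂ J))) ≤ central (r + w)
∑-intervals-⊓ r w = begin
  ∑ (intervals r) (λ I → ∑ (intervals w) (λ J → suc (proj₂ I ⊓ proj₂ J)))
    ≤⟨ ∑-mono∈ (intervals r) (λ {I} I∈ → ∑-mono∈ (intervals w) λ {J} J∈ →
         subst (λ m → suc (proj₂ I ⊓ proj₂ J) ≤ conv (inInterval I) (inInterval J) m) (middle I J I∈ J∈)
           (conv-inInterval (proj₁ I) (proj₂ I) (proj₁ J) (proj₂ J))) ⟩
  ∑ (intervals r) (λ I → ∑ (intervals w) (λ J → conv (inInterval I) (inInterval J) ⌊ r + w /2⌋))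
    ≡⟨ conv-∑ (intervals r) (intervals w) inInterval inInterval ⌊ r + w /2⌋ ⟩
  conv (λ i → ∑ (intervals r) (λ I → inInterval I i)) (λ i → ∑ (intervals w) (λ J → inInterval J i)) ⌊ r + w /2⌋
    ≡⟨ conv-congˡ _ ⌊ r + w /2⌋ (intervals-count r) ⟩
  conv (r C_) (λ i → ∑ (intervals w) (λ J → inInterval J i)) ⌊ r + w /2⌋
    ≡⟨ conv-comm (r C_) _ ⌊ r + w /2⌋ ⟩
  conv (λ i → ∑ (intervals w) (λ J → inInterval J i)) (r C_) ⌊ r + w /2⌋
    ≡⟨ conv-congˡ _ ⌊ r + w /2⌋ (intervals-count w) ⟩
  conv (w C_) (r C_) ⌊ r + w /2⌋
    ≡⟨ conv-comm (w C_) (r C_) ⌊ r + w /2⌋ ⟩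
  conv (r C_) (w C_) ⌊ r + w /2⌋
    ≡⟨ vandermonde r w ⌊ r + w /2⌋ ⟩
  central (r + w) ∎
  where
  open ≤-Reasoning
  middle : ∀ I J → I ∈ˡ intervals r → J ∈ˡ intervals w →
           proj₁ I + (proj₁ J + ⌊ proj₂ I + proj₂ J /2⌋) ≡ ⌊ r + w /2⌋
  middle (α , ℓ) (β , ℓ′) I∈ J∈ = sym (trans
    (cong ⌊_/2⌋ (trans (cong₂ _+_ (sym (intervals-symmetric r I∈)) (sym (intervals-symmetric w J∈))) (lemma α ℓ β ℓ′)))
    (trans (⌊a+b+a/2⌋ (α + β) (ℓ + ℓ′)) (+-assoc α β _)))
    where
    lemma : ∀ a l b l′ → a + l + a + (b + l′ + b) ≡ a + b + (l + l′) + (a + b)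
    lemma = solve-∀

-- Every symmetric interval contains the middle rank.
length-intervals≤ : ∀ r → length (intervals r) ≤ central r
length-intervals≤ r = begin
  length (intervals r)                                ≡⟨ length≡∑1 (intervals r) ⟩
  ∑ (intervals r) (λ _ → 1)                           ≤⟨ ∑-mono∈ (intervals r) (λ {I} I∈ → contains I I∈) ⟩
  ∑ (intervals r) (λ I → inInterval I ⌊ r /2⌋)        ≡⟨ intervals-count r ⌊ r /2⌋ ⟩
  central r                                           ∎
  where
  open ≤-Reasoning
  shift : ∀ α ℓ t → t ≤ ℓ → inInterval (α , ℓ) (α + t) ≡ 1
  shift zero    ℓ t t≤ℓ = le-yes t≤ℓ
  shift (suc α) ℓ t t≤ℓ = shift α ℓ t t≤ℓ
  contains : ∀ I → I ∈ˡ intervals r → 1 ≤ inInterval I ⌊ r /2⌋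
  contains (α , ℓ) I∈ = ≤-reflexive (sym (trans
    (cong (inInterval (α , ℓ)) (trans (cong ⌊_/2⌋ (sym (intervals-symmetric r I∈))) (⌊a+b+a/2⌋ α ℓ)))
    (shift α ℓ ⌊ ℓ /2⌋ (⌊n/2⌋≤n ℓ))))

-- Growth of the central binomial coefficient

/2≡⌊/2⌋ : ∀ n → n / 2 ≡ ⌊ n /2⌋
/2≡⌊/2⌋ zero          = refl
/2≡⌊/2⌋ (suc zero)    = refl
/2≡⌊/2⌋ (suc (suc n)) = trans (m/n≡1+[m∸n]/n {suc (suc n)} {2} (s≤s (s≤s z≤n))) (cong suc (/2≡⌊/2⌋ n))

halve : ∀ n → ∃ λ m → n ≡ m + m ⊎ n ≡ suc (m + m)
halve zero = 0 , inj₁ refl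
halve (suc n) with halve n
... | m , inj₁ refl = m , inj₂ refl
... | m , inj₂ refl = suc m , inj₁ (cong suc (sym (+-suc m m)))

central-even : ∀ m → central (m + m) ≡ (m + m) C m
central-even m = cong ((m + m) C_) (sym (n≡⌊n+n/2⌋ m))

C-odd-symmetric : ∀ m → suc (m + m) C suc m ≡ suc (m + m) C m
C-odd-symmetric m = trans (nCk≡nC[n∸k] (s≤s (m≤m+n m m))) (cong (suc (m + m) C_) (m+n∸m≡n m m))

central-odd : ∀ m → central (suc (m + m)) ≡ suc (m + m) C m
central-odd m = cong (suc (m + m) C_) (sym (n≡⌈n+n/2⌉ m))

C-absorption : ∀ a f → suc a * (suc (a + f) C suc a) ≡ suc (a + f) * ((a + f) C a)
C-absorption a f = *-cancelʳ-≡ _ _ (a ! * f !) {{a !* f !≢0}} (begin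
  suc a * (suc (a + f) C suc a) * (a ! * f !)       ≡⟨ lemma (suc a) (suc (a + f) C suc a) (a !) (f !) ⟩
  (suc (a + f) C suc a) * (suc a ! * f !)           ≡⟨ C-factorial (suc a) f ⟩
  suc (a + f) * (a + f) !                           ≡⟨ cong (suc (a + f) *_) (C-factorial a f) ⟨
  suc (a + f) * (((a + f) C a) * (a ! * f !))       ≡⟨ *-assoc (suc (a + f)) ((a + f) C a) (a ! * f !) ⟨
  suc (a + f) * ((a + f) C a) * (a ! * f !)         ∎)
  where
  open ≡-Reasoning
  lemma : ∀ a b c d → a * b * (c * d) ≡ b * (a * c * d)
  lemma = solve-∀

central-odd-step : ∀ m → suc m * central (suc (m + m)) ≡ suc (m + m) * central (m + m)
central-odd-step m = begin
  suc m * central (suc (m + m))        ≡⟨ cong (suc m *_) (trans (central-odd m) (sym (C-odd-symmetric m))) ⟩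
  suc m * (suc (m + m) C suc m)        ≡⟨ C-absorption m m ⟩
  suc (m + m) * ((m + m) C m)          ≡⟨ cong (suc (m + m) *_) (central-even m) ⟨
  suc (m + m) * central (m + m)        ∎
  where open ≡-Reasoning

central-even-step : ∀ m → central (suc (suc (m + m))) ≡ 2 * central (suc (m + m))
central-even-step m = begin
  central (suc (suc (m + m)))                           ≡⟨ cong (λ k → suc (suc (m + m)) C suc k) (n≡⌊n+n/2⌋ m) ⟨
  suc (suc (m + m)) C suc m                             ≡⟨ nCk+nC[k+1]≡[n+1]C[k+1] (suc (m + m)) m ⟨
  suc (m + m) C m + suc (m + m) C suc m                 ≡⟨ cong (suc (m + m) C m +_) (trans (C-odd-symmetric m) (sym (+-identityʳ _))) ⟩
  2 * (suc (m + m) C m)                                 ≡⟨ cong (2 *_) (central-odd m) ⟨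
  2 * central (suc (m + m))                             ∎
  where open ≡-Reasoning

-- So `central n * suc n`, divided by `2 ^ n`, never decreases: the ratio is constant from even to
-- odd `n`, and `central` exactly doubles from odd to even. The telescoped form loses only
-- `(n + 1) / (r + 1)`, which is near 1 when few elements are added.
central-growth-step : ∀ n → 2 * central n * suc n ≤ central (suc n) * suc (suc n)
central-growth-step n with halve n
... | m , inj₁ refl = ≤-reflexive (begin
  2 * central (m + m) * suc (m + m)              ≡⟨ lemma (central (m + m)) (suc (m + m)) ⟩
  2 * (suc (m + m) * central (m + m))            ≡⟨ cong (2 *_) (central-odd-step m) ⟨
  2 * (suc m * central (suc (m + m)))            ≡⟨ lemma′ m (central (suc (m + m))) ⟩
  central (suc (m + m)) * suc (suc (m + m))      ∎)
  where
  open ≡-Reasoning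
  lemma : ∀ a b → 2 * a * b ≡ 2 * (b * a)
  lemma = solve-∀
  lemma′ : ∀ m c → 2 * (suc m * c) ≡ c * suc (suc (m + m))
  lemma′ = solve-∀
... | m , inj₂ refl = *-mono-≤ (≤-reflexive (sym (central-even-step m))) (n≤1+n _)

central-growth : ∀ w r → 2 ^ w * central r * suc r ≤ central (w + r) * suc (w + r)
central-growth zero    r = ≤-reflexive (cong (_* suc r) (*-identityˡ (central r)))
central-growth (suc w) r = begin
  2 ^ suc w * central r * suc r                ≡⟨ lemma (2 ^ w) (central r) (suc r) ⟩
  2 * (2 ^ w * central r * suc r)              ≤⟨ *-monoʳ-≤ 2 (central-growth w r) ⟩
  2 * (central (w + r) * suc (w + r))          ≡⟨ *-assoc 2 (central (w + r)) (suc (w + r)) ⟨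
  2 * central (w + r) * suc (w + r)            ≤⟨ central-growth-step (w + r) ⟩
  central (suc w + r) * suc (suc w + r)        ∎
  where
  open ≤-Reasoning
  lemma : ∀ p c s → 2 * p * c * s ≡ 2 * (p * c * s)
  lemma = solve-∀

2^n≤central*suc : ∀ n → 2 ^ n ≤ central n * suc n
2^n≤central*suc n = subst₂ _≤_ (trans (*-identityʳ _) (*-identityʳ _)) (cong (λ m → central m * suc m) (+-identityʳ n)) (central-growth n 0)

central-even-recurrence : ∀ m → suc m * central (suc (suc (m + m))) ≡ 2 * (suc (m + m) * central (m + m))
central-even-recurrence m = begin
  suc m * central (suc (suc (m + m)))            ≡⟨ cong (suc m *_) (central-even-step m) ⟩
  suc m * (2 * central (suc (m + m)))            ≡⟨ lemma (suc m) (central (suc (m + m))) ⟩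
  2 * (suc m * central (suc (m + m)))            ≡⟨ cong (2 *_) (central-odd-step m) ⟩
  2 * (suc (m + m) * central (m + m))            ∎
  where
  open ≡-Reasoning
  lemma : ∀ a b → a * (2 * b) ≡ 2 * (a * b)
  lemma = solve-∀

-- With `q = suc m` this is the square of the estimate `4 ^ q / (2 √q)` for the central coefficient
-- of `2 q`. The induction works because `(2 q + 1) ^ 2` exceeds `4 q (q + 1)` by 1. The order √q
-- matters: the linear loss in `2^n≤central*suc` would force `d` beyond o(n).
16^m≤ : ∀ m → 16 ^ suc m ≤ 4 * suc m * (central (suc (suc (m + m))) * central (suc (suc (m + m))))
16^m≤ zero    = ≤-refl
16^m≤ (suc m) rewrite +-suc m m = *-cancelʳ-≤ _ _ (suc q) (begin
  16 * 16 ^ q * suc q                                    ≡⟨ *-assoc 16 (16 ^ q) (suc q) ⟩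
  16 * (16 ^ q * suc q)                                  ≤⟨ *-monoʳ-≤ 16 (*-monoˡ-≤ (suc q) (subst (λ n → 16 ^ q ≤ 4 * q * (central n * central n)) 2q (16^m≤ m))) ⟩
  16 * (4 * q * (c * c) * suc q)                         ≤⟨ m≤m+n _ (16 * (c * c)) ⟩
  16 * (4 * q * (c * c) * suc q) + 16 * (c * c)          ≡⟨ lemma q c ⟩
  4 * (2 * (suc (q + q) * c) * (2 * (suc (q + q) * c)))  ≡⟨ cong (λ x → 4 * (x * x)) (central-even-recurrence q) ⟨
  4 * (suc q * c′ * (suc q * c′))                        ≡⟨ lemma′ (suc q) c′ ⟩
  4 * suc q * (c′ * c′) * suc q                          ≡⟨ cong (λ n → 4 * suc q * (central n * central n) * suc q) (cong (λ n → suc (suc n)) (sym 2q)) ⟩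
  4 * suc q * (central (4 + (m + m)) * central (4 + (m + m))) * suc q  ∎)
  where
  open ≤-Reasoning
  q = suc m
  c = central (q + q)
  c′ = central (suc (suc (q + q)))
  2q : suc (suc (m + m)) ≡ q + q
  2q = cong suc (sym (+-suc m m))
  lemma : ∀ q c → 16 * (4 * q * (c * c) * suc q) + 16 * (c * c) ≡ 4 * (2 * (suc (q + q) * c) * (2 * (suc (q + q) * c)))
  lemma = solve-∀
  lemma′ : ∀ s c → 4 * (s * c * (s * c)) ≡ 4 * s * (c * c) * s
  lemma′ = solve-∀

16^suc : ∀ m → 16 ^ suc m ≡ 4 * (4 * 4 ^ (m + m))
16^suc m = begin
  16 * 16 ^ m               ≡⟨ cong (16 *_) (^-distribʳ-* m 4 4) ⟩
  16 * (4 ^ m * 4 ^ m)      ≡⟨ cong (16 *_) (^-distribˡ-+-* 4 m m) ⟨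
  16 * 4 ^ (m + m)          ≡⟨ *-assoc 4 4 (4 ^ (m + m)) ⟩
  4 * (4 * 4 ^ (m + m))     ∎
  where open ≡-Reasoning

-- Odd `n` is reduced to the even number after it, where `central` is exactly twice as large.
4^n≤central² : ∀ n → 4 ^ n ≤ 2 * suc n * (central n * central n)
4^n≤central² n with halve n
... | zero , inj₁ refl = s≤s z≤n
... | suc m , inj₁ refl rewrite +-suc m m = begin
  4 * (4 * 4 ^ (m + m))         ≡⟨ 16^suc m ⟨
  16 ^ suc m                    ≤⟨ 16^m≤ m ⟩
  4 * suc m * (c * c)           ≤⟨ *-monoˡ-≤ (c * c) (≤-trans (m≤m+n (4 * suc m) 2) (≤-reflexive (lemma m))) ⟩
  2 * (3 + (m + m)) * (c * c)   ∎
  where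
  open ≤-Reasoning
  c = central (suc (suc (m + m)))
  lemma : ∀ m → 4 * suc m + 2 ≡ 2 * (3 + (m + m))
  lemma = solve-∀
... | m , inj₂ refl = *-cancelˡ-≤ 4 (begin
  4 * (4 * 4 ^ (m + m))                  ≡⟨ 16^suc m ⟨
  16 ^ suc m                             ≤⟨ 16^m≤ m ⟩
  4 * suc m * (central (2 + (m + m)) * central (2 + (m + m)))  ≡⟨ cong (λ x → 4 * suc m * (x * x)) (central-even-step m) ⟩
  4 * suc m * (2 * c * (2 * c))          ≡⟨ lemma m c ⟩
  4 * (2 * suc (suc (m + m)) * (c * c))  ∎)
  where
  open ≤-Reasoning
  c = central (suc (m + m))
  lemma : ∀ m c → 4 * suc m * (2 * c * (2 * c)) ≡ 4 * (2 * suc (suc (m + m)) * (c * c))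
  lemma = solve-∀

-- Counting points on lines

𝟙 : {P : Set} → Dec P → ℕ
𝟙 (yes _) = 1
𝟙 (no _)  = 0

𝟙-yes : {P : Set} (P? : Dec P) → P → 𝟙 P? ≡ 1
𝟙-yes (yes _) p = refl
𝟙-yes (no ¬p) p = contradiction p ¬p

𝟙-mono : {P Q : Set} (P? : Dec P) (Q? : Dec Q) → (P → Q) → 𝟙 P? ≤ 𝟙 Q?
𝟙-mono (no _)  Q? f = z≤n
𝟙-mono (yes p) Q? f = ≤-reflexive (sym (𝟙-yes Q? (f p)))

module _ {X : Set} {P : X → Set} (P? : Decidable P) where

  length-filter-∑ : ∀ V → length (filter P? V) ≡ ∑ V (λ u → 𝟙 (P? u))
  length-filter-∑ []      = refl
  length-filter-∑ (u ∷ V) with P? u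
  ... | yes _ = cong suc (length-filter-∑ V)
  ... | no _  = length-filter-∑ V

  ∑-filter≤ : ∀ V f → ∑ (filter P? V) f ≤ ∑ V f
  ∑-filter≤ []      f = z≤n
  ∑-filter≤ (u ∷ V) f with P? u
  ... | yes _ = +-monoʳ-≤ (f u) (∑-filter≤ V f)
  ... | no _  = ≤-trans (∑-filter≤ V f) (m≤n+m _ (f u))

-- Every point on a line (a fibre of κ) beyond the first causes a collision.
line-bound : {X K : Set} (_≟ᴷ_ : DecidableEquality K) (κ : X → K) (g : X → ℕ) (c : X → X → ℕ) →
  (∀ u → g u ≤ 1) →
  (∀ {u v} → u ≢ v → g u ≡ 1 → g v ≡ 1 → κ u ≡ κ v → 1 ≤ c u v) →
  ∀ V → Unique V → ∀ ks → (∀ {u} → u ∈ˡ V → g u ≡ 1 → κ u ∈ˡ ks) →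
  ∑ V g ≤ length ks + ∑ V (λ u → ∑ V (λ v → g u * g v * c u v))
line-bound _≟ᴷ_ κ g c g≤1 collide []      _         ks κ∈ = z≤n
line-bound _≟ᴷ_ κ g c g≤1 collide (u ∷ V) (u# ∷ V#) ks κ∈ = main (≤1-cases (g≤1 u))
  where
  open ≤-Reasoning
  h : _ → _ → ℕ
  h v v′ = g v * g v′ * c v v′
  row = ∑ V (h u)
  rest = ∑ V (λ v → ∑ V (h v))
  whole = ∑ (u ∷ V) (λ v → ∑ (u ∷ V) (h v))
  split : row + rest ≤ whole
  split = +-mono-≤ (m≤n+m row (h u u)) (∑-mono V λ v → m≤n+m (∑ V (h v)) (h v u))
  IH : ∀ ks → (∀ {v} → v ∈ˡ V → g v ≡ 1 → κ v ∈ˡ ks) → ∑ V g ≤ length ks + rest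
  IH = line-bound _≟ᴷ_ κ g c g≤1 collide V V#
  main : g u ≡ 0 ⊎ g u ≡ 1 → g u + ∑ V g ≤ length ks + whole
  main (inj₁ gu≡0) = begin
    g u + ∑ V g           ≡⟨ cong (_+ ∑ V g) gu≡0 ⟩
    ∑ V g                 ≤⟨ IH ks (λ v∈ → κ∈ (there v∈)) ⟩
    length ks + rest      ≤⟨ +-monoʳ-≤ (length ks) (≤-trans (m≤n+m rest row) split) ⟩
    length ks + whole     ∎
  main (inj₂ gu≡1) with any? (λ v → (g v ≟ 1) ×-dec (κ u ≟ᴷ κ v)) V
  -- Another point `v` on the line of `u` lies in the rest of the list, and the pair of `u` and `v`
  -- pays for `u`.
  ... | yes some with find some
  ...   | v , v∈ , gv≡1 , κ≡ = begin
    g u + ∑ V g                   ≡⟨ cong (_+ ∑ V g) gu≡1 ⟩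
    suc (∑ V g)                   ≤⟨ s≤s (IH ks (λ v∈ → κ∈ (there v∈))) ⟩
    suc (length ks + rest)        ≡⟨ +-suc (length ks) rest ⟨
    length ks + suc rest          ≤⟨ +-monoʳ-≤ (length ks) (+-monoˡ-≤ rest 1≤row) ⟩
    length ks + (row + rest)      ≤⟨ +-monoʳ-≤ (length ks) split ⟩
    length ks + whole             ∎
    where
    1≤row : 1 ≤ row
    1≤row = begin
      1                 ≤⟨ collide (All.lookup u# v∈) gu≡1 gv≡1 κ≡ ⟩
      c u v             ≡⟨ *-identityˡ (c u v) ⟨
      1 * c u v         ≡⟨ cong₂ (λ a b → a * b * c u v) gu≡1 gv≡1 ⟨
      h u v             ≤⟨ ∑-∈ (h u) v∈ ⟩
      row               ∎
  -- No remaining point shares the line of `u`, so that line can be struck off the list and pays for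
  -- `u`.
  main (inj₂ gu≡1) | no none = begin
    g u + ∑ V g                   ≡⟨ cong (_+ ∑ V g) gu≡1 ⟩
    suc (∑ V g)                   ≤⟨ s≤s (IH ks′ λ v∈ gv≡1 → ∈-filter⁺ other? (κ∈ (there v∈) gv≡1) λ κ≡ → none (lose v∈ (gv≡1 , κ≡))) ⟩
    suc (length ks′ + rest)       ≤⟨ +-monoˡ-≤ rest (filter-notAll other? ks (lose (κ∈ (here refl) gu≡1) λ ≢ → ≢ refl)) ⟩
    length ks + rest              ≤⟨ +-monoʳ-≤ (length ks) (≤-trans (m≤n+m rest row) split) ⟩
    length ks + whole             ∎
    where
    other? : Decidable (λ k → κ u ≢ k)
    other? k = ¬? (κ u ≟ᴷ k)
    ks′ = filter other? ks

-- Edges and the lines of a grid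

_≟ˢ_ : ∀ {n} → DecidableEquality (Subset n)
_≟ˢ_ = ≡-dec Bool._≟_

subsets : ∀ n → List (Subset n)
subsets zero    = [] ∷ []
subsets (suc n) = map (true ∷_) (subsets n) ++ map (false ∷_) (subsets n)

∈-subsets : ∀ {n} (A : Subset n) → A ∈ˡ subsets n
∈-subsets []          = here refl
∈-subsets (true ∷ A)  = ∈-++⁺ˡ (∈-map⁺ _ (∈-subsets A))
∈-subsets (false ∷ A) = ∈-++⁺ʳ _ (∈-map⁺ _ (∈-subsets A))

length-subsets : ∀ n → length (subsets n) ≡ 2 ^ n
length-subsets zero    = refl
length-subsets (suc n) = begin
  length (subsets (suc n))                                ≡⟨ length-++ (map (true ∷_) (subsets n)) ⟩
  length (map (true ∷_) (subsets n)) + length (map (false ∷_) (subsets n))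
                                                          ≡⟨ cong₂ _+_ (length-map _ (subsets n)) (length-map _ (subsets n)) ⟩
  length (subsets n) + length (subsets n)                 ≡⟨ cong₂ _+_ (length-subsets n) (trans (length-subsets n) (sym (+-identityʳ (2 ^ n)))) ⟩
  2 ^ suc n                                               ∎
  where open ≡-Reasoning

-- The maps `x` and `y` stand for the traces of a set on the two colour classes. An edge has its
-- difference entirely in the second class; the other kind of edge arises by exchanging `x` and `y`.
Edge : ∀ {X : Set} {a b} (x : X → Subset a) (y : X → Subset b) → X → X → Set
Edge x y u v = x u ≡ x v × y u ≢ y v × (y u ⊆ y v ⊎ y v ⊆ y u)

edge? : ∀ {X : Set} {a b} (x : X → Subset a) (y : X → Subset b) u v → Dec (Edge x y u v)
edge? x y u v = (x u ≟ˢ x v) ×-dec (¬? (y u ≟ˢ y v) ×-dec ((y u ⊆? y v) ⊎-dec (y v ⊆? y u)))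

ranks : ℕ × ℕ → List ℕ
ranks (α , ℓ) = map (α +_) (upTo (suc ℓ))

length-ranks : ∀ α ℓ → length (ranks (α , ℓ)) ≡ suc ℓ
length-ranks α ℓ = trans (length-map (α +_) (upTo (suc ℓ))) (length-upTo (suc ℓ))

∈-ranks : ∀ I i → inInterval I i ≡ 1 → i ∈ˡ ranks I
∈-ranks (α , ℓ) i eq with inInterval⇒ α ℓ i eq
... | t , t≤ℓ , refl = ∈-map⁺ (α +_) (∈-upTo⁺ (s≤s t≤ℓ))

∑-swap₂ : ∀ {X Y Z : Set} (xs : List X) (ys : List Y) (zs : List Z) (f : X → Y → Z → ℕ) →
  ∑ xs (λ a → ∑ ys (λ b → ∑ zs (f a b))) ≡ ∑ zs (λ c → ∑ xs (λ a → ∑ ys (λ b → f a b c)))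
∑-swap₂ xs ys zs f =
  trans (∑-cong xs λ a → ∑-swap ys zs (f a)) (∑-swap xs zs (λ a c → ∑ ys (λ b → f a b c)))

rank-span : ∀ {r} → Chain r → ℕ
rank-span (_ , _ , ℓ) = ℓ

∑-codes-const : ∀ r c → ∑ (codes r) (λ _ → c) ≡ r ! * c
∑-codes-const r c = trans (∑-const (codes r) c) (cong (_* c) (length-codes r))

∑-chains-⊓ : ∀ r w → ∑ (chains r) (λ s → ∑ (chains w) (λ t → suc (rank-span s ⊓ rank-span t))) ≤ r ! * w ! * central (r + w)
∑-chains-⊓ r w = begin
  ∑ (chains r) (λ s → ∑ (chains w) (λ t → suc (rank-span s ⊓ rank-span t)))
    ≡⟨ ∑-cartesianProduct (codes r) (intervals r) _ ⟩
  ∑ (codes r) (λ _ → ∑ (intervals r) (λ I → ∑ (chains w) (λ t → suc (proj₂ I ⊓ rank-span t))))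
    ≡⟨ ∑-codes-const r _ ⟩
  r ! * ∑ (intervals r) (λ I → ∑ (chains w) (λ t → suc (proj₂ I ⊓ rank-span t)))
    ≡⟨ cong (r ! *_) (∑-cong (intervals r) λ I → trans (∑-cartesianProduct (codes w) (intervals w) _)
         (∑-codes-const w _)) ⟩
  r ! * ∑ (intervals r) (λ I → w ! * ∑ (intervals w) (λ J → suc (proj₂ I ⊓ proj₂ J)))
    ≡⟨ cong (r ! *_) (∑-*ˡ (intervals r) (w !) _) ⟩
  r ! * (w ! * ∑ (intervals r) (λ I → ∑ (intervals w) (λ J → suc (proj₂ I ⊓ proj₂ J))))
    ≡⟨ *-assoc (r !) (w !) _ ⟨
  r ! * w ! * ∑ (intervals r) (λ I → ∑ (intervals w) (λ J → suc (proj₂ I ⊓ proj₂ J)))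
    ≤⟨ *-monoʳ-≤ (r ! * w !) (∑-intervals-⊓ r w) ⟩
  r ! * w ! * central (r + w) ∎
  where open ≤-Reasoning

inChain⇒ : ∀ {r} (s : Chain r) A → inChain s A ≡ 1 → onChain (proj₁ s) A ≡ 1 × inInterval (proj₂ s) ∣ A ∣ ≡ 1
inChain⇒ (p , I) A = *≡1 (onChain p A) (inInterval I ∣ A ∣)

module _ {X : Set} {r w : ℕ} (x : X → Subset r) (y : X → Subset w)
         (jointly-injective : ∀ {u v} → x u ≡ x v → y u ≡ y v → u ≡ v) where

  grid : Chain r → Chain w → X → ℕ
  grid s t u = inChain s (x u) * inChain t (y u)

  -- A line fixes the rank of the trace `x`, hence within the chain `s` the trace itself. Two
  -- members on one line then differ only in `y`, where both traces lie on one chain, so they form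
  -- an edge.
  grid-line-bound : ∀ s t V → Unique V →
    ∑ V (grid s t) ≤ suc (rank-span s) + ∑ V (λ u → ∑ V (λ v → grid s t u * grid s t v * 𝟙 (edge? x y u v)))
  grid-line-bound s@(p , α , ℓ) t@(q , β , ℓ′) V V# =
    ≤-trans
      (line-bound _≟_ (λ u → ∣ x u ∣) (grid s t) (λ u v → 𝟙 (edge? x y u v))
        (λ u → *-≤1 (inChain≤1 s (x u)) (inChain≤1 t (y u)))
        (λ u≢v gu gv κ≡ → ≤-reflexive (sym (𝟙-yes (edge? x y _ _) (edge u≢v gu gv κ≡))))
        V V# (ranks (α , ℓ))
        (λ {u} _ gu → ∈-ranks (α , ℓ) ∣ x u ∣ (proj₂ (inChain⇒ s (x u) (proj₁ (*≡1 (inChain s (x u)) _ gu))))))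
      (+-monoˡ-≤ _ (≤-reflexive (length-ranks α ℓ)))
    where
    edge : ∀ {u v} → u ≢ v → grid s t u ≡ 1 → grid s t v ≡ 1 → ∣ x u ∣ ≡ ∣ x v ∣ → Edge x y u v
    edge {u} {v} u≢v gu gv κ≡ =
      xu≡xv , (λ yu≡yv → u≢v (jointly-injective xu≡xv yu≡yv)) ,
      [ inj₁ ∘ onChain-⊆ q (y u) (y v) (on-q u gu) (on-q v gv) , inj₂ ∘ onChain-⊆ q (y v) (y u) (on-q v gv) (on-q u gu) ]′
        (≤-total ∣ y u ∣ ∣ y v ∣)
      where
      on-p : ∀ u → grid s t u ≡ 1 → onChain p (x u) ≡ 1
      on-p u gu = proj₁ (inChain⇒ s (x u) (proj₁ (*≡1 (inChain s (x u)) _ gu)))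
      on-q : ∀ u → grid s t u ≡ 1 → onChain q (y u) ≡ 1
      on-q u gu = proj₁ (inChain⇒ t (y u) (proj₂ (*≡1 (inChain s (x u)) _ gu)))
      xu≡xv = onChain-same-size p (on-p u gu) (on-p v gv) κ≡

  -- Here a line fixes the whole trace `y` and runs along the chain `s`, so there are `2 ^ w` lines.
  single-chain-bound : ∀ s V → Unique V →
    ∑ V (λ u → inChain s (x u)) ≤ 2 ^ w + ∑ V (λ u → ∑ V (λ v → inChain s (x u) * inChain s (x v) * 𝟙 (edge? y x u v)))
  single-chain-bound s@(p , I) V V# =
    ≤-trans
      (line-bound _≟ˢ_ y (λ u → inChain s (x u)) (λ u v → 𝟙 (edge? y x u v))
        (λ u → inChain≤1 s (x u))
        (λ {u} {v} u≢v gu gv κ≡ → ≤-reflexive (sym (𝟙-yes (edge? y x u v)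
          (κ≡ , (λ xu≡xv → u≢v (jointly-injective xu≡xv κ≡)) ,
            [ inj₁ ∘ onChain-⊆ p (x u) (x v) (proj₁ (inChain⇒ s (x u) gu)) (proj₁ (inChain⇒ s (x v) gv))
            , inj₂ ∘ onChain-⊆ p (x v) (x u) (proj₁ (inChain⇒ s (x v) gv)) (proj₁ (inChain⇒ s (x u) gu)) ]′ (≤-total ∣ x u ∣ ∣ x v ∣)))))
        V V# (subsets w) (λ {u} _ _ → ∈-subsets (y u)))
      (+-monoˡ-≤ _ (≤-reflexive (length-subsets w)))

  -- With `y` empty, the trace `x` determines the point: lines are the fibres of `x`, and collisions
  -- are impossible.
  empty-part-bound : ∀ V → Unique V → (∀ {u} → u ∈ˡ V → ∣ y u ∣ ≡ 0) → length V ≤ 2 ^ r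
  empty-part-bound V V# empty = begin
    length V                                                                   ≡⟨ length≡∑1 V ⟩
    ∑ V (λ _ → 1)                                                              ≤⟨ ∑-mono∈ V (λ u∈ → ≤-reflexive (sym (isEmpty-yes (empty u∈)))) ⟩
    ∑ V isEmpty                                                                ≤⟨ line-bound _≟ˢ_ x isEmpty (λ _ _ → 0) (λ u → isEmpty≤1 u)
                                                                                    (λ u≢v gu gv κ≡ → contradiction (jointly-injective κ≡ (unique gu gv)) u≢v)
                                                                                    V V# (subsets r) (λ {u} _ _ → ∈-subsets (x u)) ⟩
    length (subsets r) + ∑ V (λ u → ∑ V (λ v → isEmpty u * isEmpty v * 0))     ≡⟨ cong₂ _+_ (length-subsets r) no-collisions ⟩
    2 ^ r + 0                                                                  ≡⟨ +-identityʳ (2 ^ r) ⟩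
    2 ^ r                                                                      ∎
    where
    open ≤-Reasoning
    isEmpty : X → ℕ
    isEmpty u = 𝟙 (∣ y u ∣ ≟ 0)
    isEmpty-yes : ∀ {u} → ∣ y u ∣ ≡ 0 → isEmpty u ≡ 1
    isEmpty-yes {u} = 𝟙-yes (∣ y u ∣ ≟ 0)
    isEmpty≤1 : ∀ u → isEmpty u ≤ 1
    isEmpty≤1 u with ∣ y u ∣ ≟ 0
    ... | yes _ = ≤-refl
    ... | no _  = z≤n
    size0 : ∀ {n} (A B : Subset n) → ∣ A ∣ ≡ 0 → ∣ B ∣ ≡ 0 → A ≡ B
    size0 []          []          _ _ = refl
    size0 (false ∷ A) (false ∷ B) a b = cong (false ∷_) (size0 A B a b)
    unique : ∀ {u v} → isEmpty u ≡ 1 → isEmpty v ≡ 1 → y u ≡ y v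
    unique {u} {v} gu gv with ∣ y u ∣ ≟ 0 | ∣ y v ∣ ≟ 0
    ... | yes a | yes b = size0 (y u) (y v) a b
    no-collisions : ∑ V (λ u → ∑ V (λ v → isEmpty u * isEmpty v * 0)) ≡ 0
    no-collisions = trans (∑-cong V λ u → trans (∑-cong V λ v → *-zeroʳ (isEmpty u * isEmpty v)) (∑-zero V)) (∑-zero V)

-- Averaging over chains

edge-pairs-bound : ∀ {X : Set} {r w} (x : X → Subset r) (y : X → Subset w) u v →
  1 ≤ ∣ y u ∣ → 1 ≤ ∣ y v ∣ →
  w * (∑-pairs (y u) (y v) * 𝟙 (edge? x y u v)) ≤ 2 * w ! * 𝟙 (edge? x y u v)
edge-pairs-bound {w = w} x y u v 1≤u 1≤v with edge? x y u v
... | no _ = ≤-trans (≤-reflexive (trans (cong (w *_) (*-zeroʳ (∑-pairs (y u) (y v)))) (*-zeroʳ w))) z≤n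
... | yes (_ , y≢ , _) = begin
  w * (∑-pairs (y u) (y v) * 1)    ≡⟨ cong (w *_) (*-identityʳ _) ⟩
  w * ∑-pairs (y u) (y v)          ≤⟨ ∑-pairs-bound (y u) (y v) y≢ 1≤u 1≤v ⟩
  2 * w !                          ≡⟨ *-identityʳ _ ⟨
  2 * w ! * 1                      ∎
  where open ≤-Reasoning

module _ {X : Set} {r w : ℕ} (x : X → Subset r) (y : X → Subset w)
         (jointly-injective : ∀ {u v} → x u ≡ x v → y u ≡ y v → u ≡ v) where

  private
    open ≤-Reasoning
    ex ey : X → X → ℕ
    ex u v = 𝟙 (edge? x y u v)
    ey u v = 𝟙 (edge? y x u v)

  -- Lines run parallel to the longer side, so that their number comes from the shorter one. Adding
  -- both kinds of edges makes the collision term the same for either direction.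
  grid-bound : ∀ s t V → Unique V →
    ∑ V (grid x y jointly-injective s t) ≤
    suc (rank-span s ⊓ rank-span t) +
    ∑ V (λ u → ∑ V (λ v → grid x y jointly-injective s t u * grid x y jointly-injective s t v * (ex u v + ey u v)))
  grid-bound s t V V# = [ shorter-s , shorter-t ]′ (≤-total (rank-span s) (rank-span t))
    where
    g = grid x y jointly-injective s t
    g′ = grid y x (λ p q → jointly-injective q p) t s
    g′≡g : ∀ u → g′ u ≡ g u
    g′≡g u = *-comm (inChain t (y u)) (inChain s (x u))
    shorter-s : rank-span s ≤ rank-span t → _
    shorter-s s≤t = begin
      ∑ V g                                                            ≤⟨ grid-line-bound x y jointly-injective s t V V# ⟩
      suc (rank-span s) + ∑ V (λ u → ∑ V (λ v → g u * g v * ex u v))   ≤⟨ +-mono-≤ (s≤s (≤-reflexive (sym (m≤n⇒m⊓n≡m s≤t))))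
                                                                            (∑-mono V λ u → ∑-mono V λ v → *-monoʳ-≤ (g u * g v) (m≤m+n (ex u v) (ey u v))) ⟩
      suc (rank-span s ⊓ rank-span t) + ∑ V (λ u → ∑ V (λ v → g u * g v * (ex u v + ey u v))) ∎
    shorter-t : rank-span t ≤ rank-span s → _
    shorter-t t≤s = begin
      ∑ V g                                                               ≡⟨ ∑-cong V g′≡g ⟨
      ∑ V g′                                                              ≤⟨ grid-line-bound y x (λ p q → jointly-injective q p) t s V V# ⟩
      suc (rank-span t) + ∑ V (λ u → ∑ V (λ v → g′ u * g′ v * ey u v))    ≤⟨ +-mono-≤ (s≤s (≤-reflexive (sym (m≥n⇒m⊓n≡n t≤s))))
                                                                              (∑-mono V λ u → ∑-mono V λ v → *-mono-≤ (≤-reflexive (cong₂ _*_ (g′≡g u) (g′≡g v))) (m≤n+m (ey u v) (ex u v))) ⟩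
      suc (rank-span s ⊓ rank-span t) + ∑ V (λ u → ∑ V (λ v → g u * g v * (ex u v + ey u v))) ∎

  -- This is `grid-bound` summed over all pairs of chains: every member is counted `r ! * w !`
  -- times. After division the error is `2 d (1 / r + 1 / w)` per member.
  two-sided-bound : ∀ d V → Unique V → (∀ {u} → u ∈ˡ V → 1 ≤ ∣ x u ∣) → (∀ {u} → u ∈ˡ V → 1 ≤ ∣ y u ∣) →
    (∀ {u} → u ∈ˡ V → ∑ V (ex u) ≤ d) → (∀ {u} → u ∈ˡ V → ∑ V (ey u) ≤ d) →
    length V * (r * w) ≤ central (r + w) * (r * w) + 2 * (r + w) * d * length V
  two-sided-bound d V V# 1≤x 1≤y deg-x deg-y = *-cancelˡ-≤ (r ! * w !) {{r !* w !≢0}} (begin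
    r ! * w ! * (L * (r * w))                                  ≡⟨ rearrange₁ (r ! * w !) L (r * w) ⟩
    r * w * (L * (r ! * w !))                                  ≡⟨ cong (r * w *_) total ⟨
    r * w * ∑ (chains r) (λ s → ∑ (chains w) (λ t → ∑ V (g s t)))
                                                               ≤⟨ *-monoʳ-≤ (r * w) (∑-mono (chains r) λ s → ∑-mono (chains w) λ t → grid-bound s t V V#) ⟩
    r * w * ∑ (chains r) (λ s → ∑ (chains w) (λ t → suc (rank-span s ⊓ rank-span t) + coll s t))
                                                               ≡⟨ cong (r * w *_) (trans (∑-cong (chains r) λ s → ∑-+ (chains w) _ (coll s)) (∑-+ (chains r) _ _)) ⟩
    r * w * (∑ (chains r) (λ s → ∑ (chains w) (λ t → suc (rank-span s ⊓ rank-span t))) + ∑ (chains r) (λ s → ∑ (chains w) (coll s)))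
                                                               ≤⟨ *-monoʳ-≤ (r * w) (+-mono-≤ (∑-chains-⊓ r w) (≤-reflexive collisions)) ⟩
    r * w * (r ! * w ! * central (r + w) + ∑ V (λ u → ∑ V (λ v → pairs u v)))
                                                               ≡⟨ *-distribˡ-+ (r * w) _ _ ⟩
    r * w * (r ! * w ! * central (r + w)) + r * w * ∑ V (λ u → ∑ V (λ v → pairs u v))
                                                               ≤⟨ +-monoʳ-≤ (r * w * (r ! * w ! * central (r + w))) few-collisions ⟩
    r * w * (r ! * w ! * central (r + w)) + L * (2 * r ! * w ! * (r * d + w * d))
                                                               ≡⟨ rearrange₂ r w (r !) (w !) (central (r + w)) L d ⟩
    r ! * w ! * (central (r + w) * (r * w) + 2 * (r + w) * d * L) ∎)
    where
    L = length V
    g = grid x y jointly-injective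
    coll : Chain r → Chain w → ℕ
    coll s t = ∑ V (λ u → ∑ V (λ v → g s t u * g s t v * (ex u v + ey u v)))
    Px Py pairs : X → X → ℕ
    Px u v = ∑-pairs (x u) (x v)
    Py u v = ∑-pairs (y u) (y v)
    pairs u v = Px u v * Py u v * (ex u v + ey u v)
    rearrange₁ : ∀ a b c → a * (b * c) ≡ c * (b * a)
    rearrange₁ = solve-∀
    rearrange₂ : ∀ r w R W c L d → r * w * (R * W * c) + L * (2 * R * W * (r * d + w * d)) ≡ R * W * (c * (r * w) + 2 * (r + w) * d * L)
    rearrange₂ = solve-∀
    four : ∀ a b c d e → a * b * (c * d) * e ≡ a * c * (b * d) * e
    four = solve-∀
    total : ∑ (chains r) (λ s → ∑ (chains w) (λ t → ∑ V (g s t))) ≡ L * (r ! * w !)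
    total = trans (∑-swap₂ (chains r) (chains w) V g) (trans
      (∑-cong V λ u → trans (∑-product (chains r) (chains w) _ _) (cong₂ _*_ (chains-cover (x u)) (chains-cover (y u))))
      (∑-const V (r ! * w !)))
    collisions : ∑ (chains r) (λ s → ∑ (chains w) (coll s)) ≡ ∑ V (λ u → ∑ V (pairs u))
    collisions = trans (∑-swap₂ (chains r) (chains w) V (λ s t u → ∑ V (λ v → g s t u * g s t v * (ex u v + ey u v))))
      (∑-cong V λ u → trans (∑-swap₂ (chains r) (chains w) V (λ s t v → g s t u * g s t v * (ex u v + ey u v)))
        (∑-cong V λ v → trans (∑-cong (chains r) λ s → trans (∑-cong (chains w) λ t → four (inChain s (x u)) (inChain t (y u)) (inChain s (x v)) (inChain t (y v)) (ex u v + ey u v))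
                                                             (∑-*ʳ (chains w) (ex u v + ey u v) _))
          (trans (∑-*ʳ (chains r) (ex u v + ey u v) _) (cong (_* (ex u v + ey u v)) (∑-product (chains r) (chains w) _ _)))))
    -- The ends of an `ex` edge agree in `x`, so only their meeting on a chain in `y` is rare: `Px`
    -- gets the trivial bound `r !`, and the factor `w` is spent on `Py`. For `ey` the roles are
    -- exchanged.
    pair-bound : ∀ {u v} → u ∈ˡ V → v ∈ˡ V → r * w * pairs u v ≤ 2 * r ! * w ! * (r * ex u v + w * ey u v)
    pair-bound {u} {v} u∈ v∈ = begin
      r * w * (Px u v * Py u v * (ex u v + ey u v))
        ≡⟨ lemma r w (Px u v) (Py u v) (ex u v) (ey u v) ⟩
      r * Px u v * (w * (Py u v * ex u v)) + w * Py u v * (r * (Px u v * ey u v))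
        ≤⟨ +-mono-≤ (*-mono-≤ (*-monoʳ-≤ r (∑-pairs≤! (x u) (x v))) (edge-pairs-bound x y u v (1≤y u∈) (1≤y v∈)))
                    (*-mono-≤ (*-monoʳ-≤ w (∑-pairs≤! (y u) (y v))) (edge-pairs-bound y x u v (1≤x u∈) (1≤x v∈))) ⟩
      r * r ! * (2 * w ! * ex u v) + w * w ! * (2 * r ! * ey u v)
        ≡⟨ lemma′ r w (r !) (w !) (ex u v) (ey u v) ⟩
      2 * r ! * w ! * (r * ex u v + w * ey u v) ∎
      where
      lemma : ∀ r w P Q e f → r * w * (P * Q * (e + f)) ≡ r * P * (w * (Q * e)) + w * Q * (r * (P * f))
      lemma = solve-∀
      lemma′ : ∀ r w R W e f → r * R * (2 * W * e) + w * W * (2 * R * f) ≡ 2 * R * W * (r * e + w * f)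
      lemma′ = solve-∀
    few-collisions : r * w * ∑ V (λ u → ∑ V (pairs u)) ≤ L * (2 * r ! * w ! * (r * d + w * d))
    few-collisions = begin
      r * w * ∑ V (λ u → ∑ V (pairs u))
        ≡⟨ trans (∑-cong V λ u → ∑-*ˡ V (r * w) (pairs u)) (∑-*ˡ V (r * w) _) ⟨
      ∑ V (λ u → ∑ V (λ v → r * w * pairs u v))
        ≤⟨ ∑-mono∈ V (λ {u} u∈ → begin
             ∑ V (λ v → r * w * pairs u v)                                         ≤⟨ ∑-mono∈ V (λ v∈ → pair-bound u∈ v∈) ⟩
             ∑ V (λ v → 2 * r ! * w ! * (r * ex u v + w * ey u v))                 ≡⟨ ∑-*ˡ V (2 * r ! * w !) _ ⟩
             2 * r ! * w ! * ∑ V (λ v → r * ex u v + w * ey u v)                   ≡⟨ cong (2 * r ! * w ! *_) (trans (∑-+ V _ _) (cong₂ _+_ (∑-*ˡ V r (ex u)) (∑-*ˡ V w (ey u)))) ⟩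
             2 * r ! * w ! * (r * ∑ V (ex u) + w * ∑ V (ey u))                     ≤⟨ *-monoʳ-≤ (2 * r ! * w !) (+-mono-≤ (*-monoʳ-≤ r (deg-x u∈)) (*-monoʳ-≤ w (deg-y u∈))) ⟩
             2 * r ! * w ! * (r * d + w * d)                                       ∎) ⟩
      ∑ V (λ u → 2 * r ! * w ! * (r * d + w * d))
        ≡⟨ ∑-const V _ ⟩
      L * (2 * r ! * w ! * (r * d + w * d)) ∎

  -- Each code contributes `length (intervals r) * 2 ^ w` lines, at most `2 ^ w * central r`. Only
  -- `ey` edges can collide, at cost `2 / r` each.
  one-sided-bound : ∀ d V → Unique V → (∀ {u} → u ∈ˡ V → 1 ≤ ∣ x u ∣) →
    (∀ {u} → u ∈ˡ V → ∑ V (ey u) ≤ d) →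
    length V * r ≤ 2 ^ w * central r * r + 2 * d * length V
  one-sided-bound d V V# 1≤x deg-y = *-cancelˡ-≤ (r !) {{r !≢0}} (begin
    r ! * (L * r)                                                       ≡⟨ rearrange₁ (r !) L r ⟩
    r * (L * r !)                                                       ≡⟨ cong (r *_) total ⟨
    r * ∑ (chains r) (λ s → ∑ V (λ u → inChain s (x u)))                ≤⟨ *-monoʳ-≤ r (∑-mono (chains r) λ s → single-chain-bound x y jointly-injective s V V#) ⟩
    r * ∑ (chains r) (λ s → 2 ^ w + coll s)                             ≡⟨ cong (r *_) (∑-+ (chains r) _ coll) ⟩
    r * (∑ (chains r) (λ _ → 2 ^ w) + ∑ (chains r) coll)                ≡⟨ cong (r *_) (cong₂ _+_ lines collisions) ⟩
    r * (r ! * (length (intervals r) * 2 ^ w) + ∑ V (λ u → ∑ V (λ v → Px u v * ey u v)))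
                                                                        ≤⟨ *-monoʳ-≤ r (+-monoˡ-≤ _ (*-monoʳ-≤ (r !) (*-monoˡ-≤ (2 ^ w) (length-intervals≤ r)))) ⟩
    r * (r ! * (central r * 2 ^ w) + ∑ V (λ u → ∑ V (λ v → Px u v * ey u v)))
                                                                        ≡⟨ *-distribˡ-+ r _ _ ⟩
    r * (r ! * (central r * 2 ^ w)) + r * ∑ V (λ u → ∑ V (λ v → Px u v * ey u v))
                                                                        ≤⟨ +-monoʳ-≤ (r * (r ! * (central r * 2 ^ w))) few-collisions ⟩
    r * (r ! * (central r * 2 ^ w)) + L * (2 * r ! * d)                 ≡⟨ rearrange₂ r (r !) (central r) (2 ^ w) L d ⟩
    r ! * (2 ^ w * central r * r + 2 * d * L)                           ∎)
    where
    L = length V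
    Px : X → X → ℕ
    Px u v = ∑-pairs (x u) (x v)
    coll : Chain r → ℕ
    coll s = ∑ V (λ u → ∑ V (λ v → inChain s (x u) * inChain s (x v) * ey u v))
    rearrange₁ : ∀ a b c → a * (b * c) ≡ c * (b * a)
    rearrange₁ = solve-∀
    rearrange₂ : ∀ r R c W L d → r * (R * (c * W)) + L * (2 * R * d) ≡ R * (W * c * r + 2 * d * L)
    rearrange₂ = solve-∀
    total : ∑ (chains r) (λ s → ∑ V (λ u → inChain s (x u))) ≡ L * r !
    total = trans (∑-swap (chains r) V _) (trans (∑-cong V λ u → chains-cover (x u)) (∑-const V (r !)))
    lines : ∑ (chains r) (λ _ → 2 ^ w) ≡ r ! * (length (intervals r) * 2 ^ w)
    lines = trans (∑-cartesianProduct (codes r) (intervals r) _)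
      (trans (∑-codes-const r _) (cong (r ! *_) (∑-const (intervals r) (2 ^ w))))
    collisions : ∑ (chains r) coll ≡ ∑ V (λ u → ∑ V (λ v → Px u v * ey u v))
    collisions = trans (∑-swap (chains r) V _) (∑-cong V λ u → trans (∑-swap (chains r) V _)
      (∑-cong V λ v → ∑-*ʳ (chains r) (ey u v) _))
    few-collisions : r * ∑ V (λ u → ∑ V (λ v → Px u v * ey u v)) ≤ L * (2 * r ! * d)
    few-collisions = begin
      r * ∑ V (λ u → ∑ V (λ v → Px u v * ey u v))
        ≡⟨ trans (∑-cong V λ u → ∑-*ˡ V r _) (∑-*ˡ V r _) ⟨
      ∑ V (λ u → ∑ V (λ v → r * (Px u v * ey u v)))
        ≤⟨ ∑-mono∈ V (λ {u} u∈ → begin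
             ∑ V (λ v → r * (Px u v * ey u v))      ≤⟨ ∑-mono∈ V (λ {v} v∈ → edge-pairs-bound y x u v (1≤x u∈) (1≤x v∈)) ⟩
             ∑ V (λ v → 2 * r ! * ey u v)           ≡⟨ ∑-*ˡ V (2 * r !) (ey u) ⟩
             2 * r ! * ∑ V (ey u)                   ≤⟨ *-monoʳ-≤ (2 * r !) (deg-y u∈) ⟩
             2 * r ! * d                            ∎) ⟩
      ∑ V (λ u → 2 * r ! * d)
        ≡⟨ ∑-const V _ ⟩
      L * (2 * r ! * d) ∎

-- Counting independent sets

-- The inequality `(1 + 1 / N) ^ j * (1 - j / N) ≤ 1` without denominators, where `a` is `N - j`.
-- Each step uses `(N + 1) a ≤ N (a + 1)`, valid as `a ≤ N`.
bernoulli : ∀ N j a → j + a ≡ N → suc N ^ j * a ≤ N ^ suc j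
bernoulli N zero    a eq = ≤-reflexive (trans (*-identityˡ a) (trans eq (sym (*-identityʳ N))))
bernoulli N (suc j) a eq = begin
  suc N * suc N ^ j * a        ≡⟨ lemma (suc N) (suc N ^ j) a ⟩
  suc N ^ j * (suc N * a)      ≤⟨ *-monoʳ-≤ (suc N ^ j) (+-mono-≤ (≤-trans (m≤n+m a (suc j)) (≤-reflexive eq)) (≤-reflexive (*-comm N a))) ⟩
  suc N ^ j * (suc a * N)      ≡⟨ *-assoc (suc N ^ j) (suc a) N ⟨
  suc N ^ j * suc a * N        ≤⟨ *-monoˡ-≤ N (bernoulli N j (suc a) (trans (+-suc j a) eq)) ⟩
  N ^ suc j * N                ≡⟨ *-comm (N ^ suc j) N ⟩
  N ^ suc (suc j)              ∎
  where
  open ≤-Reasoning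
  lemma : ∀ a b c → a * b * c ≡ b * (a * c)
  lemma = solve-∀

suc-power≤ : ∀ k .{{_ : NonZero k}} → suc (2 * k) ^ k ≤ 2 * (2 * k) ^ k
suc-power≤ k = *-cancelʳ-≤ _ _ k (begin
  suc (2 * k) ^ k * k         ≤⟨ bernoulli (2 * k) k k (cong (k +_) (sym (+-identityʳ k))) ⟩
  2 * k * (2 * k) ^ k         ≡⟨ lemma k ((2 * k) ^ k) ⟩
  2 * (2 * k) ^ k * k         ∎)
  where
  open ≤-Reasoning
  lemma : ∀ k p → 2 * k * p ≡ 2 * p * k
  lemma = solve-∀

-- Integer form of T(m - 1) + T(m - 1 - d) ≤ T(m) for T(m) = 2^(m/k).
+-power≤ : ∀ k .{{_ : NonZero k}} d a b P → (2 * k) ^ k ≤ 2 ^ d →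
           a ^ k ≤ P → b ^ k * 2 ^ d ≤ P → (a + b) ^ k ≤ 2 * P
+-power≤ k d a b P k≤d a≤ b≤ = *-cancelʳ-≤ _ _ ((2 * k) ^ k) {{m^n≢0 (2 * k) k {{m*n≢0 2 k}}}} (begin
  (a + b) ^ k * (2 * k) ^ k           ≡⟨ ^-distribʳ-* k (a + b) (2 * k) ⟨
  ((a + b) * (2 * k)) ^ k             ≤⟨ ^-monoˡ-≤ k ab≤z ⟩
  (z * suc (2 * k)) ^ k               ≡⟨ ^-distribʳ-* k z (suc (2 * k)) ⟩
  z ^ k * suc (2 * k) ^ k             ≤⟨ *-mono-≤ (z≤ (⊔-sel a (2 * k * b))) (suc-power≤ k) ⟩
  P * (2 * (2 * k) ^ k)               ≡⟨ lemma P ((2 * k) ^ k) ⟩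
  2 * P * (2 * k) ^ k                 ∎)
  where
  open ≤-Reasoning
  -- By the choice of `z`, `a + b` is at most `z (1 + 1 / (2 k))`, whose `k`th power is at most
  -- `2 * z ^ k`. The hypothesis on `d` says that `b` may be multiplied by `2 * k` within the bound
  -- `P`.
  z = a ⊔ 2 * k * b
  lemma : ∀ p q → p * (2 * q) ≡ 2 * p * q
  lemma = solve-∀
  lemma′ : ∀ z k → z * k + z ≡ z * suc k
  lemma′ = solve-∀
  z≤ : z ≡ a ⊎ z ≡ 2 * k * b → z ^ k ≤ P
  z≤ (inj₁ eq) = subst (λ m → m ^ k ≤ P) (sym eq) a≤
  z≤ (inj₂ eq) = subst (λ m → m ^ k ≤ P) (sym eq) (begin
    (2 * k * b) ^ k           ≡⟨ ^-distribʳ-* k (2 * k) b ⟩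
    (2 * k) ^ k * b ^ k       ≤⟨ *-monoˡ-≤ (b ^ k) k≤d ⟩
    2 ^ d * b ^ k             ≡⟨ *-comm (2 ^ d) (b ^ k) ⟩
    b ^ k * 2 ^ d             ≤⟨ b≤ ⟩
    P                         ∎)
  ab≤z : (a + b) * (2 * k) ≤ z * suc (2 * k)
  ab≤z = begin
    (a + b) * (2 * k)              ≡⟨ *-distribʳ-+ (2 * k) a b ⟩
    a * (2 * k) + b * (2 * k)      ≡⟨ cong (a * (2 * k) +_) (*-comm b (2 * k)) ⟩
    a * (2 * k) + 2 * k * b        ≤⟨ +-mono-≤ (*-monoˡ-≤ (2 * k) (m≤m⊔n a (2 * k * b))) (m≤n⊔m a (2 * k * b)) ⟩
    z * (2 * k) + z                ≡⟨ lemma′ z (2 * k) ⟩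
    z * suc (2 * k)                ∎

length-filter-complement : ∀ {X : Set} {P : X → Set} (P? : Decidable P) V →
                           length (filter P? V) + length (filter (¬? ∘ P?) V) ≡ length V
length-filter-complement P? []      = refl
length-filter-complement P? (u ∷ V) with P? u
... | yes _ = cong suc (length-filter-complement P? V)
... | no _  = trans (+-suc _ _) (cong suc (length-filter-complement P? V))

module Container {X : Set} (_≟ˣ_ : DecidableEquality X) {N : ℕ} (code : X → Fin N)
  (code-injective : ∀ {u v} → code u ≡ code v → u ≡ v) (code-surjective : ∀ i → ∃ λ u → code u ≡ i)
  (E : X → X → Set) (E? : ∀ u v → Dec (E u v)) where

  Independent : Subset N → Set
  Independent s = ∀ {u v} → code u ∈ s → code v ∈ s → ¬ E u v

  -- The vertex itself is included, so more than `d` closed neighbours means that choosing `v`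
  -- removes at least `d + 1` vertices.
  Closed : X → X → Set
  Closed v u = u ≡ v ⊎ E v u

  closed? : ∀ v u → Dec (Closed v u)
  closed? v u = (u ≟ˣ v) ⊎-dec E? v u

  Covers : List X → List (Subset N) → Set
  Covers V L = ∀ s → Independent s → (∀ {u} → code u ∈ s → u ∈ˡ V) → s ∈ˡ L

  covers-[] : Covers [] (⊥ ∷ [])
  covers-[] s _ s⊆ = here (Empty-unique λ (i , i∈) → empty i i∈)
    where
    empty : ∀ i → ¬ (i ∈ s)
    empty i i∈ with code-surjective i
    ... | u , refl with s⊆ i∈
    ...   | ()

  branch : X → List (Subset N) → List (Subset N) → List (Subset N)
  branch v L₁ L₂ = L₁ ++ map (_[ code v ]≔ inside) L₂

  length-branch : ∀ v L₁ L₂ → length (branch v L₁ L₂) ≡ length L₁ + length L₂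
  length-branch v L₁ L₂ = trans (length-++ L₁) (cong (length L₁ +_) (length-map _ L₂))

  -- An independent set avoids `v`, or it contains `v` and no neighbour of it. In the second case
  -- `v` is deleted before the recursive list is consulted and is put back by `branch`.
  covers-branch : ∀ {V V₁ V₂ L₁ L₂} v →
    (∀ {u} → u ∈ˡ V → u ≢ v → u ∈ˡ V₁) → (∀ {u} → u ∈ˡ V → ¬ Closed v u → u ∈ˡ V₂) →
    Covers V₁ L₁ → Covers V₂ L₂ → Covers V (branch v L₁ L₂)
  covers-branch {L₁ = L₁} {L₂} v V₁⊇ V₂⊇ cov₁ cov₂ s ind s⊆ with code v ∈? s
  ... | no v∉ = ∈-++⁺ˡ (cov₁ s ind λ u∈ → V₁⊇ (s⊆ u∈) λ { refl → v∉ u∈ })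
  ... | yes v∈ = ∈-++⁺ʳ L₁ (subst (_∈ˡ map _ L₂) s″≡s (∈-map⁺ (_[ code v ]≔ inside) (cov₂ s′ ind′ s′⊆)))
    where
    s′ = s [ code v ]≔ outside
    s″≡s : s′ [ code v ]≔ inside ≡ s
    s″≡s = trans ([]≔-idempotent s (code v)) (trans (cong (s [ code v ]≔_) (sym ([]=⇒lookup v∈))) ([]≔-lookup s (code v)))
    u≢v : ∀ {u} → code u ∈ s′ → u ≢ v
    u≢v u∈ refl with trans (sym ([]=⇒lookup u∈)) (lookup∘update (code v) s outside)
    ... | ()
    s′⊆s : ∀ {u} → code u ∈ s′ → code u ∈ s
    s′⊆s {u} u∈ = lookup⇒[]= (code u) s (trans (sym (lookup∘update′ (u≢v u∈ ∘ code-injective) s outside)) ([]=⇒lookup u∈))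
    ind′ : Independent s′
    ind′ u∈ w∈ = ind (s′⊆s u∈) (s′⊆s w∈)
    s′⊆ : ∀ {u} → code u ∈ s′ → u ∈ˡ _
    s′⊆ u∈ = V₂⊇ (s⊆ (s′⊆s u∈)) [ u≢v u∈ , ind v∈ (s′⊆s u∈) ]′

  covers-all : ∀ V → ∃ λ L → Covers V L × length L ≡ 2 ^ length V
  covers-all []      = _ , covers-[] , refl
  covers-all (v ∷ V) with covers-all V
  ... | L , cov , len = branch v L L ,
    covers-branch {V = v ∷ V} {V} {V} v
      (λ { (here refl) u≢v → contradiction refl u≢v ; (there u∈) _ → u∈ })
      (λ { (here refl) ¬cl → contradiction (inj₁ refl) ¬cl ; (there u∈) _ → u∈ }) cov cov ,
    trans (length-branch v L L) (cong₂ _+_ len (trans len (sym (+-identityʳ _))))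

  module _ (M d k : ℕ) .{{_ : NonZero k}} (k≤d : (2 * k) ^ k ≤ 2 ^ d)
    (dense : ∀ V → Unique V → M < length V → ∃ λ v → v ∈ˡ V × d < length (filter (closed? v) V)) where

    open ≤-Reasoning

    -- The bound is `2 ^ (M + length V / k)` raised to the power `k`. With at most `M` vertices
    -- left, all subsets are listed; otherwise one branch loses a vertex, the other `d + 1`, and
    -- `+-power≤` closes the recurrence. The number `m` only bounds the depth of the recursion.
    container′ : ∀ m V → Unique V → length V ≤ m → ∃ λ L → Covers V L × length L ^ k ≤ 2 ^ (M * k + length V)
    container′ m V V# V≤m with ≤-<-connex (length V) M
    ... | inj₁ V≤M with covers-all V
    ...   | L , cov , len = L , cov , (begin
      length L ^ k              ≡⟨ cong (_^ k) len ⟩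
      (2 ^ length V) ^ k        ≡⟨ ^-*-assoc 2 (length V) k ⟩
      2 ^ (length V * k)        ≤⟨ ^-monoʳ-≤ 2 (≤-trans (*-monoˡ-≤ k V≤M) (m≤m+n (M * k) (length V))) ⟩
      2 ^ (M * k + length V)    ∎)
    container′ zero V V# V≤0 | inj₂ M<V = contradiction (≤-trans M<V V≤0) λ ()
    container′ (suc m) V V# V≤m | inj₂ M<V with dense V V# M<V
    ... | v , v∈ , many = branch v L₁ L₂ ,
      covers-branch {V = V} {V₁} {V₂} v (∈-filter⁺ (¬? ∘ (_≟ˣ v))) (∈-filter⁺ (¬? ∘ closed? v)) (proj₁ (proj₂ rec₁)) (proj₁ (proj₂ rec₂)) ,
      (begin
        length (branch v L₁ L₂) ^ k             ≡⟨ cong (_^ k) (length-branch v L₁ L₂) ⟩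
        (length L₁ + length L₂) ^ k             ≤⟨ +-power≤ k d (length L₁) (length L₂) (2 ^ (M * k + n)) k≤d L₁≤ L₂≤ ⟩
        2 ^ suc (M * k + n)                     ≡⟨ cong (2 ^_) (trans (sym (+-suc (M * k) n)) (cong (M * k +_) n≡)) ⟩
        2 ^ (M * k + length V)                  ∎)
      where
      V₁ = filter (¬? ∘ (_≟ˣ v)) V
      V₂ = filter (¬? ∘ closed? v) V
      n = pred (length V)
      n≡ : suc n ≡ length V
      n≡ = suc-pred (length V) {{>-nonZero (≤-trans z<s M<V)}}
      V₁< : length V₁ < length V
      V₁< = filter-notAll (¬? ∘ (_≟ˣ v)) V (lose v∈ λ v≢v → v≢v refl)
      V₂+ : length V₂ + suc d ≤ length V
      V₂+ = begin
        length V₂ + suc d                             ≤⟨ +-monoʳ-≤ (length V₂) many ⟩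
        length V₂ + length (filter (closed? v) V)     ≡⟨ +-comm (length V₂) _ ⟩
        length (filter (closed? v) V) + length V₂     ≡⟨ length-filter-complement (closed? v) V ⟩
        length V                                      ∎
      V₂< : length V₂ < length V
      V₂< = ≤-trans (≤-trans (≤-reflexive (+-comm 1 (length V₂))) (+-monoʳ-≤ (length V₂) (s≤s z≤n))) V₂+
      rec₁ = container′ m V₁ (filter⁺ (¬? ∘ (_≟ˣ v)) V#) (s≤s⁻¹ (≤-trans V₁< V≤m))
      rec₂ = container′ m V₂ (filter⁺ (¬? ∘ closed? v) V#) (s≤s⁻¹ (≤-trans V₂< V≤m))
      L₁ = proj₁ rec₁
      L₂ = proj₁ rec₂
      L₁≤ : length L₁ ^ k ≤ 2 ^ (M * k + n)
      L₁≤ = ≤-trans (proj₂ (proj₂ rec₁)) (^-monoʳ-≤ 2 (+-monoʳ-≤ (M * k) (s≤s⁻¹ (≤-trans V₁< (≤-reflexive (sym n≡))))))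
      L₂≤ : length L₂ ^ k * 2 ^ d ≤ 2 ^ (M * k + n)
      L₂≤ = begin
        length L₂ ^ k * 2 ^ d                   ≤⟨ *-monoˡ-≤ (2 ^ d) (proj₂ (proj₂ rec₂)) ⟩
        2 ^ (M * k + length V₂) * 2 ^ d         ≡⟨ ^-distribˡ-+-* 2 (M * k + length V₂) d ⟨
        2 ^ (M * k + length V₂ + d)             ≤⟨ ^-monoʳ-≤ 2 (begin
          M * k + length V₂ + d                   ≡⟨ +-assoc (M * k) (length V₂) d ⟩
          M * k + (length V₂ + d)                 ≤⟨ +-monoʳ-≤ (M * k) (s≤s⁻¹ (≤-trans (≤-reflexive (sym (+-suc (length V₂) d))) (≤-trans V₂+ (≤-reflexive (sym n≡))))) ⟩
          M * k + n                               ∎) ⟩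
        2 ^ (M * k + n)                         ∎

    container : ∀ V → Unique V → ∃ λ L → Covers V L × length L ^ k ≤ 2 ^ (M * k + length V)
    container V V# = container′ (length V) V V# ≤-refl

-- Comparing `count` with the length of a list

tails : ∀ {m} → Bool → List (Subset (suc m)) → List (Subset m)
tails b     []                = []
tails true  ((true ∷ s) ∷ L)  = s ∷ tails true L
tails true  ((false ∷ s) ∷ L) = tails true L
tails false ((true ∷ s) ∷ L)  = tails false L
tails false ((false ∷ s) ∷ L) = s ∷ tails false L

length-tails : ∀ {m} (L : List (Subset (suc m))) → length (tails true L) + length (tails false L) ≡ length L
length-tails []                = refl
length-tails ((true ∷ s) ∷ L)  = cong suc (length-tails L)
length-tails ((false ∷ s) ∷ L) = trans (+-suc _ _) (cong suc (length-tails L))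

∈-tails : ∀ {m} b {s : Subset m} {L} → (b ∷ s) ∈ˡ L → s ∈ˡ tails b L
∈-tails true  (here refl) = here refl
∈-tails false (here refl) = here refl
∈-tails true  {L = (true ∷ _) ∷ _}  (there s∈) = there (∈-tails true s∈)
∈-tails true  {L = (false ∷ _) ∷ _} (there s∈) = ∈-tails true s∈
∈-tails false {L = (true ∷ _) ∷ _}  (there s∈) = ∈-tails false s∈
∈-tails false {L = (false ∷ _) ∷ _} (there s∈) = there (∈-tails false s∈)

-- Sorting the list by first entries mirrors the recursion of `count`. The list may repeat sets, as
-- it will for families that are good for several partitions.
count≤length : ∀ {m} {P : Subset m → Set} (P? : ∀ s → Dec (P s)) L → (∀ s → P s → s ∈ˡ L) → count P? ≤ length L
count≤length {zero} P? L P⊆L with P? []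
... | no _  = z≤n
... | yes p with P⊆L [] p
...   | here _  = s≤s z≤n
...   | there _ = s≤s z≤n
count≤length {suc m} P? L P⊆L = ≤-trans
  (+-mono-≤ (count≤length (P? ∘ (inside ∷_)) (tails true L) λ s p → ∈-tails true (P⊆L _ p))
            (count≤length (P? ∘ (outside ∷_)) (tails false L) λ s p → ∈-tails false (P⊆L _ p)))
  (≤-reflexive (length-tails L))

-- Supersaturation

open ≤-Reasoning

square≤2^ : ∀ {m} → 4 ≤ m → m * m ≤ 2 ^ m
square≤2^ {m} 4≤m = subst (λ m → m * m ≤ 2 ^ m) (m+[n∸m]≡n 4≤m) (go (m ∸ 4))
  where
  lemma : ∀ t → 2 * ((4 + t) * (4 + t)) ≡ (5 + t) * (5 + t) + (t * t + 6 * t + 7)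
  lemma = solve-∀
  go : ∀ t → (4 + t) * (4 + t) ≤ 2 ^ (4 + t)
  go zero    = ≤-refl
  go (suc t) = begin
    (4 + suc t) * (4 + suc t)                      ≡⟨ cong (λ a → a * a) (+-suc 4 t) ⟩
    (5 + t) * (5 + t)                              ≤⟨ m≤m+n _ _ ⟩
    (5 + t) * (5 + t) + (t * t + 6 * t + 7)        ≡⟨ lemma t ⟨
    2 * ((4 + t) * (4 + t))                        ≤⟨ *-monoʳ-≤ 2 (go t) ⟩
    2 * 2 ^ (4 + t)                                ≡⟨ cong (2 ^_) (+-suc 4 t) ⟨
    2 ^ (4 + suc t)                                ∎

square-cancel-≤ : ∀ {m n} → m * m ≤ n * n → m ≤ n
square-cancel-≤ {m} {n} mm≤nn = ≮⇒≥ λ n<m → <-irrefl refl (<-≤-trans (*-mono-< n<m n<m) mm≤nn)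

n≤2^n : ∀ n → n ≤ 2 ^ n
n≤2^n zero    = z≤n
n≤2^n (suc n) = begin
  1 + n              ≤⟨ +-mono-≤ (m^n>0 2 n) (n≤2^n n) ⟩
  2 ^ n + 2 ^ n      ≡⟨ cong (2 ^ n +_) (+-identityʳ (2 ^ n)) ⟨
  2 ^ suc n          ∎

-- There are `2 ^ w` sets with a given trace on the other part. They are negligible because `r` is
-- linear in `n`: the size condition gives `r ≥ K * suc Q + 4`, so `K * suc n` is at most `r * r`,
-- hence at most `2 ^ r`.
few-exceptions : ∀ K Q .{{_ : NonZero Q}} w r → Q * (K * suc Q + 4) ≤ w + r → w + r ≤ Q * r →
                 K * 2 ^ w ≤ central (w + r)
few-exceptions K Q w r large n≤Qr = *-cancelʳ-≤ _ _ (suc n) (begin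
  K * 2 ^ w * suc n         ≡⟨ lemma K (2 ^ w) (suc n) ⟩
  2 ^ w * (K * suc n)       ≤⟨ *-monoʳ-≤ (2 ^ w) (begin
     K * suc n                 ≤⟨ *-monoʳ-≤ K (+-mono-≤ (≤-trans (s≤s z≤n) 4≤r) n≤Qr) ⟩
     K * (suc Q * r)           ≡⟨ *-assoc K (suc Q) r ⟨
     K * suc Q * r             ≤⟨ *-monoˡ-≤ r (≤-trans (m≤m+n _ 4) r-large) ⟩
     r * r                     ≤⟨ square≤2^ 4≤r ⟩
     2 ^ r                     ∎) ⟩
  2 ^ w * 2 ^ r             ≡⟨ ^-distribˡ-+-* 2 w r ⟨
  2 ^ n                     ≤⟨ 2^n≤central*suc n ⟩
  central n * suc n         ∎)
  where
  n = w + r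
  r-large : K * suc Q + 4 ≤ r
  r-large = *-cancelˡ-≤ Q (≤-trans large n≤Qr)
  4≤r : 4 ≤ r
  4≤r = ≤-trans (m≤n+m 4 _) r-large
  lemma : ∀ a b c → a * b * c ≡ b * (a * c)
  lemma = solve-∀

-- The hypotheses say L ≤ T + L / (κ + 1), scaled by D.
absorb : ∀ κ L T D B .{{_ : NonZero D}} → L * D ≤ T * D + B * L → suc κ * B ≤ D → κ * L ≤ suc κ * T
absorb κ L T D B bound small = +-cancelˡ-≤ L _ _ (*-cancelʳ-≤ _ _ D (begin
  suc κ * L * D                          ≡⟨ *-assoc (suc κ) L D ⟩
  suc κ * (L * D)                        ≤⟨ *-monoʳ-≤ (suc κ) bound ⟩
  suc κ * (T * D + B * L)                ≡⟨ lemma (suc κ) T D B L ⟩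
  suc κ * B * L + suc κ * T * D          ≤⟨ +-monoˡ-≤ (suc κ * T * D) (*-monoˡ-≤ L small) ⟩
  D * L + suc κ * T * D                  ≡⟨ lemma′ D L (suc κ * T) ⟩
  (L + suc κ * T) * D                    ∎))
  where
  lemma : ∀ k T D B L → k * (T * D + B * L) ≡ k * B * L + k * T * D
  lemma = solve-∀
  lemma′ : ∀ D L T → D * L + T * D ≡ (L + T) * D
  lemma′ = solve-∀

module _ {X : Set} {r w : ℕ} (x : X → Subset r) (y : X → Subset w)
         (jointly-injective : ∀ {u v} → x u ≡ x v → y u ≡ y v → u ≡ v)
         (κ d : ℕ) where

  private
    -- Successive losses: `absorb` costs the factor `K / κ`, and in the one-sided case comparison
    -- with `central n` costs `Q / K`. A part is small if it has fewer than `n / Q` elements.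
    K = suc κ
    Q = suc K
    flip-injective : ∀ {u v} → y u ≡ y v → x u ≡ x v → u ≡ v
    flip-injective p q = jointly-injective q p
    nonempty : ∀ {m} → (X → Subset m) → X → Set
    nonempty z u = 1 ≤ ∣ z u ∣
    nonempty? : ∀ {m} (z : X → Subset m) → Decidable (nonempty z)
    nonempty? z u = 1 ≤? ∣ z u ∣
    empty? : ∀ {m} (z : X → Subset m) → Decidable (λ u → ∣ z u ∣ ≡ 0)
    empty? z u = ∣ z u ∣ ≟ 0
    empty-count : ∀ {a b} (z : X → Subset a) (z′ : X → Subset b) →
      (∀ {u v} → z u ≡ z v → z′ u ≡ z′ v → u ≡ v) → ∀ V → Unique V → ∑ V (λ u → 𝟙 (empty? z′ u)) ≤ 2 ^ a
    empty-count z z′ inj V V# = ≤-trans (≤-reflexive (sym (length-filter-∑ (empty? z′) V)))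
      (empty-part-bound z z′ inj (filter (empty? z′) V) (filter⁺ (empty? z′) V#) (λ u∈ → proj₂ (∈-filter⁻ (empty? z′) {xs = V} u∈)))

  -- Both parts have at least `n / Q` elements, so the error `2 n d / (r w)` is at most
  -- `2 Q ^ 2 d / n`, hence at most `1 / K`. Of the 3 extra units, one comes from `absorb` and two
  -- from the sets with an empty trace on either part.
  two-sided-degree-bound : 2 * (Q * Q) * K * d ≤ r + w → r + w ≤ Q * r → r + w ≤ Q * w →
    Q * (K * suc Q + 4) ≤ r + w →
    ∀ V → Unique V →
    (∀ {u} → u ∈ˡ V → ∑ V (λ v → 𝟙 (edge? x y u v)) ≤ d) → (∀ {u} → u ∈ˡ V → ∑ V (λ v → 𝟙 (edge? y x u v)) ≤ d) →
    κ * length V ≤ (3 + κ) * central (r + w)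
  two-sided-degree-bound d-small n≤Qr n≤Qw large V V# deg-x deg-y = begin
    κ * length V                                  ≤⟨ *-monoʳ-≤ κ split ⟩
    κ * (length V′ + (2 ^ r + 2 ^ w))             ≡⟨ lemma κ (length V′) (2 ^ r) (2 ^ w) ⟩
    κ * length V′ + (κ * 2 ^ r + κ * 2 ^ w)       ≤⟨ +-mono-≤ main (+-mono-≤ (≤-trans (*-monoˡ-≤ (2 ^ r) (n≤1+n κ)) exc-r) (≤-trans (*-monoˡ-≤ (2 ^ w) (n≤1+n κ)) exc-w)) ⟩
    K * central n + (central n + central n)       ≡⟨ lemma′ κ (central n) ⟩
    (3 + κ) * central n                           ∎
    where
    n = r + w
    positive : ∀ m → r + w ≤ Q * m → NonZero m
    positive zero    n≤ = contradiction (≤-trans (≤-trans (*-monoʳ-≤ Q (m≤n+m 4 (K * suc Q))) large) (≤-trans n≤ (≤-reflexive (*-zeroʳ Q)))) λ ()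
    positive (suc m) n≤ = _
    rw≢0 : NonZero (r * w)
    rw≢0 = m*n≢0 r w {{positive r n≤Qr}} {{positive w n≤Qw}}
    proper? : Decidable (λ u → nonempty x u × nonempty y u)
    proper? u = nonempty? x u ×-dec nonempty? y u
    V′ = filter proper? V
    from : ∀ {u} → u ∈ˡ V′ → u ∈ˡ V × nonempty x u × nonempty y u
    from u∈ = ∈-filter⁻ proper? u∈
    exc-r : K * 2 ^ r ≤ central n
    exc-r = few-exceptions K Q r w large n≤Qw
    exc-w : K * 2 ^ w ≤ central n
    exc-w = subst (λ m → K * 2 ^ w ≤ central m) (+-comm w r)
      (few-exceptions K Q w r (subst (Q * (K * suc Q + 4) ≤_) (+-comm r w) large) (subst (_≤ Q * r) (+-comm r w) n≤Qr))
    one : ∀ u → 1 ≤ 𝟙 (proper? u) + (𝟙 (empty? y u) + 𝟙 (empty? x u))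
    one u with ∣ x u ∣ | ∣ y u ∣
    ... | zero  | zero  = s≤s z≤n
    ... | zero  | suc _ = s≤s z≤n
    ... | suc _ | zero  = s≤s z≤n
    ... | suc _ | suc _ = s≤s z≤n
    split : length V ≤ length V′ + (2 ^ r + 2 ^ w)
    split = begin
      length V                                                                             ≡⟨ length≡∑1 V ⟩
      ∑ V (λ _ → 1)                                                                        ≤⟨ ∑-mono V one ⟩
      ∑ V (λ u → 𝟙 (proper? u) + (𝟙 (empty? y u) + 𝟙 (empty? x u)))                          ≡⟨ trans (∑-+ V _ _) (cong₂ _+_ (sym (length-filter-∑ proper? V)) (∑-+ V _ _)) ⟩
      length V′ + (∑ V (λ u → 𝟙 (empty? y u)) + ∑ V (λ u → 𝟙 (empty? x u)))                ≤⟨ +-monoʳ-≤ (length V′) (+-mono-≤ (empty-count x y jointly-injective V V#) (empty-count y x flip-injective V V#)) ⟩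
      length V′ + (2 ^ r + 2 ^ w)                                                          ∎
    small : K * (2 * n * d) ≤ r * w
    small = *-cancelˡ-≤ (Q * Q) (begin
      Q * Q * (K * (2 * n * d))         ≡⟨ lemma₃ (Q * Q) K n d ⟩
      n * (2 * (Q * Q) * K * d)         ≤⟨ *-monoʳ-≤ n d-small ⟩
      n * n                             ≤⟨ *-mono-≤ n≤Qr n≤Qw ⟩
      Q * r * (Q * w)                   ≡⟨ lemma₄ Q r w ⟩
      Q * Q * (r * w)                   ∎)
      where
      lemma₃ : ∀ q k n d → q * (k * (2 * n * d)) ≡ n * (2 * q * k * d)
      lemma₃ = solve-∀
      lemma₄ : ∀ q r w → q * r * (q * w) ≡ q * q * (r * w)
      lemma₄ = solve-∀
    main : κ * length V′ ≤ K * central n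
    main = absorb κ (length V′) (central n) (r * w) (2 * n * d) {{rw≢0}}
      (two-sided-bound x y jointly-injective d V′ (filter⁺ proper? V#)
        (proj₁ ∘ proj₂ ∘ from) (proj₂ ∘ proj₂ ∘ from)
        (λ u∈ → ≤-trans (∑-filter≤ proper? V _) (deg-x (proj₁ (from u∈))))
        (λ u∈ → ≤-trans (∑-filter≤ proper? V _) (deg-y (proj₁ (from u∈))))) small
    lemma : ∀ k l a b → k * (l + (a + b)) ≡ k * l + (k * a + k * b)
    lemma = solve-∀
    lemma′ : ∀ k c → suc k * c + (c + c) ≡ (3 + k) * c
    lemma′ = solve-∀

  -- The 3 extra units are one each from `absorb`, from the passage from `2 ^ w * central r` to
  -- `central n`, and from the sets with empty trace `x`.
  one-sided-degree-bound : 2 * (Q * Q) * K * d ≤ r + w → Q * w < r + w →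
    Q * (K * suc Q + 4) ≤ r + w →
    ∀ V → Unique V →
    (∀ {u} → u ∈ˡ V → ∑ V (λ v → 𝟙 (edge? y x u v)) ≤ d) →
    κ * length V ≤ (3 + κ) * central (r + w)
  one-sided-degree-bound d-small Qw<n large V V# deg-y = begin
    κ * length V                                  ≤⟨ *-monoʳ-≤ κ split ⟩
    κ * (length V′ + 2 ^ w)                       ≡⟨ *-distribˡ-+ κ (length V′) (2 ^ w) ⟩
    κ * length V′ + κ * 2 ^ w                     ≤⟨ +-mono-≤ (≤-trans main ratio) (≤-trans (*-monoˡ-≤ (2 ^ w) (n≤1+n κ)) exc-w) ⟩
    Q * central n + central n                     ≡⟨ lemma κ (central n) ⟩
    (3 + κ) * central n                           ∎
    where
    n = r + w
    Kw<r : K * w < r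
    Kw<r = +-cancelˡ-< w _ _ (subst (w + K * w <_) (+-comm r w) Qw<n)
    n≤Qr : n ≤ Q * r
    n≤Qr = +-monoʳ-≤ r (begin
      w          ≤⟨ m≤m+n w (κ * w) ⟩
      K * w      ≤⟨ <⇒≤ Kw<r ⟩
      r          ≤⟨ m≤m+n r (κ * r) ⟩
      K * r      ∎)
    r≢0 : NonZero r
    r≢0 = >-nonZero (≤-<-trans z≤n Kw<r)
    V′ = filter (nonempty? x) V
    from : ∀ {u} → u ∈ˡ V′ → u ∈ˡ V × nonempty x u
    from u∈ = ∈-filter⁻ (nonempty? x) u∈
    exc-w : K * 2 ^ w ≤ central n
    exc-w = subst (λ m → K * 2 ^ w ≤ central m) (+-comm w r)
      (few-exceptions K Q w r (subst (Q * (K * suc Q + 4) ≤_) (+-comm r w) large) (subst (_≤ Q * r) (+-comm r w) n≤Qr))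
    one : ∀ u → 1 ≤ 𝟙 (nonempty? x u) + 𝟙 (empty? x u)
    one u with ∣ x u ∣
    ... | zero  = s≤s z≤n
    ... | suc _ = s≤s z≤n
    split : length V ≤ length V′ + 2 ^ w
    split = begin
      length V                                                  ≡⟨ length≡∑1 V ⟩
      ∑ V (λ _ → 1)                                             ≤⟨ ∑-mono V one ⟩
      ∑ V (λ u → 𝟙 (nonempty? x u) + 𝟙 (empty? x u))            ≡⟨ trans (∑-+ V _ _) (cong (_+ ∑ V (λ u → 𝟙 (empty? x u))) (sym (length-filter-∑ (nonempty? x) V))) ⟩
      length V′ + ∑ V (λ u → 𝟙 (empty? x u))                    ≤⟨ +-monoʳ-≤ (length V′) (empty-count y x flip-injective V V#) ⟩
      length V′ + 2 ^ w                                         ∎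
    small : K * (2 * d) ≤ r
    small = *-cancelˡ-≤ Q (begin
      Q * (K * (2 * d))                 ≤⟨ m≤m+n _ (K * (Q * (K * (2 * d)))) ⟩
      Q * (Q * (K * (2 * d)))           ≡⟨ lemma₃ Q K d ⟩
      2 * (Q * Q) * K * d               ≤⟨ d-small ⟩
      n                                 ≤⟨ n≤Qr ⟩
      Q * r                             ∎)
      where
      lemma₃ : ∀ q k d → q * (q * (k * (2 * d))) ≡ 2 * (q * q) * k * d
      lemma₃ = solve-∀
    main : κ * length V′ ≤ K * (2 ^ w * central r)
    main = absorb κ (length V′) (2 ^ w * central r) r (2 * d) {{r≢0}}
      (one-sided-bound x y jointly-injective d V′ (filter⁺ (nonempty? x) V#) (proj₂ ∘ from)
        (λ u∈ → ≤-trans (∑-filter≤ (nonempty? x) V _) (deg-y (proj₁ (from u∈))))) small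
    -- The loss `(n + 1) / (r + 1)` in `central-growth` equals `1 + w / (r + 1)`, which is below
    -- `1 + 1 / K` since `K * w < r`.
    ratio : K * (2 ^ w * central r) ≤ Q * central n
    ratio = *-cancelʳ-≤ _ _ (suc r) (begin
      K * (2 ^ w * central r) * suc r       ≡⟨ *-assoc K (2 ^ w * central r) (suc r) ⟩
      K * (2 ^ w * central r * suc r)       ≤⟨ *-monoʳ-≤ K (central-growth w r) ⟩
      K * (central (w + r) * suc (w + r))   ≡⟨ cong (λ m → K * (central m * suc m)) (+-comm w r) ⟩
      K * (central n * suc n)               ≡⟨ lemma₃ K (central n) (suc n) ⟩
      central n * (K * suc n)               ≤⟨ *-monoʳ-≤ (central n) (begin
        K * (suc r + w)                       ≡⟨ *-distribˡ-+ K (suc r) w ⟩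
        K * suc r + K * w                     ≤⟨ +-monoʳ-≤ (K * suc r) (≤-trans (<⇒≤ Kw<r) (n≤1+n r)) ⟩
        K * suc r + suc r                     ≡⟨ +-comm (K * suc r) (suc r) ⟩
        Q * suc r                             ∎) ⟩
      central n * (Q * suc r)               ≡⟨ lemma₄ (central n) Q (suc r) ⟩
      Q * central n * suc r                 ∎)
      where
      lemma₃ : ∀ a b c → a * (b * c) ≡ b * (a * c)
      lemma₃ = solve-∀
      lemma₄ : ∀ a b c → a * (b * c) ≡ b * a * c
      lemma₄ = solve-∀
    lemma : ∀ k c → suc (suc k) * c + c ≡ (3 + k) * c
    lemma = solve-∀

degree-bound : ∀ {X : Set} {r w : ℕ} (x : X → Subset r) (y : X → Subset w)
  (jointly-injective : ∀ {u v} → x u ≡ x v → y u ≡ y v → u ≡ v) (κ d : ℕ) →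
  let K = suc κ ; Q = suc K in
  2 * (Q * Q) * K * d ≤ r + w → Q * (K * suc Q + 4) ≤ r + w →
  ∀ V → Unique V →
  (∀ {u} → u ∈ˡ V → ∑ V (λ v → 𝟙 (edge? x y u v)) ≤ d) → (∀ {u} → u ∈ˡ V → ∑ V (λ v → 𝟙 (edge? y x u v)) ≤ d) →
  κ * length V ≤ (3 + κ) * central (r + w)
degree-bound {r = r} {w} x y inj κ d d-small large V V# deg-x deg-y
  with ≤-<-connex (r + w) ((2 + κ) * r) | ≤-<-connex (r + w) ((2 + κ) * w)
... | inj₁ n≤Qr | inj₁ n≤Qw = two-sided-degree-bound x y inj κ d d-small n≤Qr n≤Qw large V V# deg-x deg-y
... | _         | inj₂ Qw<n = one-sided-degree-bound x y inj κ d d-small Qw<n large V V# deg-y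
... | inj₂ Qr<n | inj₁ _ rewrite +-comm r w =
  one-sided-degree-bound y x (λ p q → inj q p) κ d d-small Qr<n large V V# deg-x

-- Choice of parameters

power-of-4-below : ∀ n .{{_ : NonZero n}} → ∃ λ l → 4 ^ l ≤ n × n < 4 ^ suc l
power-of-4-below (suc zero) = 0 , ≤-refl , s≤s (s≤s z≤n)
power-of-4-below (suc n@(suc _)) with power-of-4-below n
... | l , 4^l≤n , n<4^l+1 with ≤-<-connex (4 ^ suc l) (suc n)
...   | inj₂ n+1<4^l+1 = l , m≤n⇒m≤1+n 4^l≤n , n+1<4^l+1
...   | inj₁ 4^l+1≤n+1 = suc l , 4^l+1≤n+1 , (begin-strict
  suc n                ≤⟨ n<4^l+1 ⟩
  4 ^ suc l            <⟨ ^-monoʳ-< 4 (s≤s (s≤s z≤n)) (n<1+n (suc l)) ⟩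
  4 ^ suc (suc l)      ∎)

-- `branching` serves the recurrence for independent sets, `sparse` and `large` serve
-- `degree-bound`. The last two fields make the exponents `2 ^ n / k` (from branching) and `n` (from
-- the choice of the partition) at most `central n / κ` each.
record Parameters (κ n : ℕ) : Set where
  field
    k d            : ℕ
    k≢0            : NonZero k
    branching      : (2 * k) ^ k ≤ 2 ^ d
    sparse         : 2 * ((2 + κ) * (2 + κ)) * suc κ * d ≤ n
    large          : (2 + κ) * (suc κ * (3 + κ) + 4) ≤ n
    few-vertices   : κ * 2 ^ n ≤ k * central n
    few-partitions : κ * n ≤ central n

-- With 4^l ≤ n < 4^(l+1), k is a large constant times √n, and d = k log₂ (2k) = o(n).
parameters : ∀ κ → ∃ λ N₀ → ∀ n → N₀ ≤ n → Parameters κ n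
parameters κ = 4 ^ L₀ + (big + 8) , λ n N₀≤n → choose n N₀≤n
  where
  K = suc κ
  Q = suc K
  -- In `4 ^ e` the factor `4 ^ κ` absorbs `κ * κ`, and the factor 16 absorbs `2 * suc n`, which is
  -- at most `16 * 4 ^ l`.
  e = 2 + κ
  P = 2 * (Q * Q) * K
  Z = P * 2 ^ e * suc e
  -- `sparse` comes down to `Z * suc l ≤ 2 ^ l`. From `l > Z` follows `Z * suc l ≤ l * l`, and
  -- `l ≥ 4` gives `l * l ≤ 2 ^ l`. The 8 in the threshold for `n` makes its half at least 4 for the
  -- same estimate.
  L₀ = Z + 4
  big = Q * (K * suc Q + 4)
  choose : ∀ n → 4 ^ L₀ + (big + 8) ≤ n → Parameters κ n
  choose n N₀≤n with power-of-4-below n {{>-nonZero (≤-trans (≤-trans z<s (m≤n+m 8 (4 ^ L₀ + big))) (≤-trans (≤-reflexive (+-assoc (4 ^ L₀) big 8)) N₀≤n))}}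
  ... | l , 4^l≤n , n<4^l+1 = record
    { k = k ; d = d ; k≢0 = m^n≢0 2 (l + e)
    -- As `2 * k` is the power `2 ^ suc (l + e)`, the condition holds with equality.
    ; branching = ≤-reflexive (^-*-assoc 2 (suc (l + e)) k)
    ; sparse = sparse′ ; large = large′ ; few-vertices = few-vertices′ ; few-partitions = few-partitions′ }
    where
    k = 2 ^ (l + e)
    d = suc (l + e) * k
    c = central n
    L₀≤l : L₀ ≤ l
    L₀≤l = ≮⇒≥ λ l<L₀ → <-irrefl refl (begin-strict
      n             <⟨ n<4^l+1 ⟩
      4 ^ suc l     ≤⟨ ^-monoʳ-≤ 4 l<L₀ ⟩
      4 ^ L₀        ≤⟨ m≤m+n _ _ ⟩
      _             ≤⟨ N₀≤n ⟩
      n             ∎)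
    large′ : big ≤ n
    large′ = ≤-trans (≤-trans (m≤m+n big 8) (m≤n+m _ (4 ^ L₀))) N₀≤n
    8≤n : 8 ≤ n
    8≤n = ≤-trans (≤-trans (m≤n+m 8 big) (m≤n+m _ (4 ^ L₀))) N₀≤n
    4^≡ : ∀ m → 4 ^ m ≡ 2 ^ m * 2 ^ m
    4^≡ m = ^-distribʳ-* m 2 2
    sparse′ : P * d ≤ n
    sparse′ = begin
      P * (suc (l + e) * 2 ^ (l + e))          ≡⟨ cong (λ x → P * (suc (l + e) * x)) (^-distribˡ-+-* 2 l e) ⟩
      P * (suc (l + e) * (2 ^ l * 2 ^ e))      ≡⟨ lemma P (suc (l + e)) (2 ^ l) (2 ^ e) ⟩
      P * 2 ^ e * suc (l + e) * 2 ^ l          ≤⟨ *-monoˡ-≤ (2 ^ l) (begin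
        P * 2 ^ e * suc (l + e)                  ≤⟨ *-monoʳ-≤ (P * 2 ^ e) (≤-trans (m≤m+n (suc (l + e)) (l * e)) (≤-reflexive (lemma₂ l e))) ⟩
        P * 2 ^ e * (suc e * suc l)              ≡⟨ *-assoc (P * 2 ^ e) (suc e) (suc l) ⟨
        Z * suc l                                ≡⟨ *-suc Z l ⟩
        Z + Z * l                                ≤⟨ +-monoˡ-≤ (Z * l) (≤-trans (m≤m+n Z 4) L₀≤l) ⟩
        suc Z * l                                ≤⟨ *-monoˡ-≤ l (≤-trans (≤-trans (≤-reflexive (+-comm 1 Z)) (+-monoʳ-≤ Z (s≤s z≤n))) L₀≤l) ⟩
        l * l                                    ≤⟨ square≤2^ (≤-trans (m≤n+m 4 Z) L₀≤l) ⟩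
        2 ^ l                                    ∎) ⟩
      2 ^ l * 2 ^ l                            ≡⟨ 4^≡ l ⟨
      4 ^ l                                    ≤⟨ 4^l≤n ⟩
      n                                        ∎
      where
      lemma : ∀ p s a b → p * (s * (a * b)) ≡ p * b * s * a
      lemma = solve-∀
      lemma₂ : ∀ l e → suc (l + e) + l * e ≡ suc e * suc l
      lemma₂ = solve-∀
    few-vertices′ : κ * 2 ^ n ≤ k * c
    few-vertices′ = square-cancel-≤ (begin
      κ * 2 ^ n * (κ * 2 ^ n)                  ≡⟨ lemma κ (2 ^ n) ⟩
      κ * κ * (2 ^ n * 2 ^ n)                  ≡⟨ cong (κ * κ *_) (4^≡ n) ⟨
      κ * κ * 4 ^ n                            ≤⟨ *-mono-≤ (*-mono-≤ (n≤2^n κ) (n≤2^n κ)) (4^n≤central² n) ⟩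
      2 ^ κ * 2 ^ κ * (2 * suc n * (c * c))    ≡⟨ cong (_* (2 * suc n * (c * c))) (4^≡ κ) ⟨
      4 ^ κ * (2 * suc n * (c * c))            ≤⟨ *-monoʳ-≤ (4 ^ κ) (*-monoˡ-≤ (c * c) (*-mono-≤ {2} {4} (s≤s (s≤s z≤n)) n<4^l+1)) ⟩
      4 ^ κ * (4 * (4 * 4 ^ l) * (c * c))      ≡⟨ lemma₂ (4 ^ κ) (4 ^ l) (c * c) ⟩
      4 ^ l * 4 ^ e * (c * c)                  ≡⟨ cong (_* (c * c)) (trans (sym (^-distribˡ-+-* 4 l e)) (4^≡ (l + e))) ⟩
      k * k * (c * c)                          ≡⟨ lemma₃ k c ⟩
      k * c * (k * c)                          ∎)
      where
      lemma : ∀ a b → a * b * (a * b) ≡ a * a * (b * b)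
      lemma = solve-∀
      lemma₂ : ∀ a b c → a * (4 * (4 * b) * c) ≡ b * (4 * (4 * a)) * c
      lemma₂ = solve-∀
      lemma₃ : ∀ a b → a * a * (b * b) ≡ a * b * (a * b)
      lemma₃ = solve-∀
    few-partitions′ : κ * n ≤ c
    few-partitions′ = begin
      κ * n                  ≤⟨ *-mono-≤ (n≤1+n κ) n≤2^w ⟩
      K * 2 ^ w              ≤⟨ few-exceptions K Q w r (subst (big ≤_) (sym w+r≡n) large′) w+r≤Qr ⟩
      central (w + r)        ≡⟨ cong central w+r≡n ⟩
      c                      ∎
      where
      w = ⌊ n /2⌋
      r = ⌈ n /2⌉
      w+r≡n : w + r ≡ n
      w+r≡n = ⌊n/2⌋+⌈n/2⌉≡n n
      w+r≤Qr : w + r ≤ Q * r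
      w+r≤Qr = ≤-trans (≤-reflexive (+-comm w r)) (+-monoʳ-≤ r (≤-trans (⌊n/2⌋≤⌈n/2⌉ n) (m≤m+n r (κ * r))))
      4≤w : 4 ≤ w
      4≤w = ⌊n/2⌋-mono 8≤n
      r≤1+w : r ≤ suc w
      r≤1+w = ⌊n/2⌋-mono (n≤1+n (suc n))
      n≤2^w : n ≤ 2 ^ w
      n≤2^w = begin
        n                ≡⟨ w+r≡n ⟨
        w + r            ≤⟨ +-monoʳ-≤ w (≤-trans r≤1+w (+-monoˡ-≤ w (≤-trans (s≤s z≤n) 4≤w))) ⟩
        w + (w + w)      ≤⟨ ≤-trans (m≤m+n _ w) (≤-reflexive (lemma w)) ⟩
        4 * w            ≤⟨ *-monoˡ-≤ w 4≤w ⟩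
        w * w            ≤⟨ square≤2^ 4≤w ⟩
        2 ^ w            ∎
        where
        lemma : ∀ w → w + (w + w) + w ≡ 4 * w
        lemma = solve-∀

-- Families of subsets

code-injective : ∀ {n} {A B : Subset n} → code A ≡ code B → A ≡ B
code-injective {A = []}        {[]}        _  = refl
code-injective {A = false ∷ A} {false ∷ B} eq = cong (false ∷_) (code-injective (proj₂ (combine-injective {2} Fin.zero (code A) Fin.zero (code B) eq)))
code-injective {A = true ∷ A}  {true ∷ B}  eq = cong (true ∷_) (code-injective (proj₂ (combine-injective {2} (Fin.suc Fin.zero) (code A) (Fin.suc Fin.zero) (code B) eq)))
code-injective {A = false ∷ A} {true ∷ B}  eq with combine-injective {2} Fin.zero (code A) (Fin.suc Fin.zero) (code B) eq
... | () , _
code-injective {A = true ∷ A}  {false ∷ B} eq with combine-injective {2} (Fin.suc Fin.zero) (code A) Fin.zero (code B) eq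
... | () , _

code-surjective : ∀ {n} (i : Fin (2 ^ n)) → ∃ λ (A : Subset n) → code A ≡ i
code-surjective {zero}  Fin.zero = [] , refl
code-surjective {suc n} i with combine-surjective {2} {2 ^ n} i
... | Fin.zero , k , refl with code-surjective {n} k
...   | A , refl = false ∷ A , refl
code-surjective {suc n} i | Fin.suc Fin.zero , k , refl with code-surjective {n} k
... | A , refl = true ∷ A , refl

subsets-unique : ∀ n → Unique (subsets n)
subsets-unique zero    = [] ∷ []
subsets-unique (suc n) = ++⁺ (map⁺ ∷-injectiveʳ (subsets-unique n)) (map⁺ ∷-injectiveʳ (subsets-unique n)) disjoint
  where
  disjoint : ∀ {A} → ¬ (A ∈ˡ map (true ∷_) (subsets n) × A ∈ˡ map (false ∷_) (subsets n))
  disjoint (A∈ , A∈′) with ∈-map⁻ (true ∷_) A∈ | ∈-map⁻ (false ∷_) A∈′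
  ... | _ , _ , refl | _ , _ , ()

-- The trace on `R`, renumbered as a subset of an initial segment, so that chains of the smaller
-- cube apply to it.
restrict : ∀ {n} (R : Subset n) → Subset n → Subset ∣ R ∣
restrict []          []      = []
restrict (true ∷ R)  (a ∷ A) = a ∷ restrict R A
restrict (false ∷ R) (a ∷ A) = restrict R A

restrict-agree : ∀ {n} (R A B : Subset n) → restrict R A ≡ restrict R B → ∀ {i} → i ∈ R → i ∈ B → i ∈ A
restrict-agree (true ∷ R)  (a ∷ A) (b ∷ B) eq here       here       with ∷-injective eq
... | refl , _ = here
restrict-agree (true ∷ R)  (a ∷ A) (b ∷ B) eq (there i∈) (there i∈B) = there (restrict-agree R A B (∷-injectiveʳ eq) i∈ i∈B)
restrict-agree (false ∷ R) (a ∷ A) (b ∷ B) eq (there i∈) (there i∈B) = there (restrict-agree R A B eq i∈ i∈B)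

∷-⊆ : ∀ {n} {a b} {A B : Subset n} {m} {C D : Subset m} → a ∷ C ⊆ b ∷ D → A ⊆ B → a ∷ A ⊆ b ∷ B
∷-⊆ {a = false}             aC⊆bD A⊆B = out⊆ A⊆B
∷-⊆ {a = true} {b = true}   aC⊆bD A⊆B = in⊆in A⊆B
∷-⊆ {a = true} {b = false}  aC⊆bD A⊆B with aC⊆bD here
... | ()

restrict-⊆ : ∀ {n} (R A B : Subset n) → restrict R A ⊆ restrict R B → restrict (∁ R) A ⊆ restrict (∁ R) B → A ⊆ B
restrict-⊆ []          []      []      _ _ = id
restrict-⊆ (true ∷ R)  (a ∷ A) (b ∷ B) p q = ∷-⊆ p (restrict-⊆ R A B (drop-∷-⊆ p) q)
restrict-⊆ (false ∷ R) (a ∷ A) (b ∷ B) p q = ∷-⊆ q (restrict-⊆ R A B p (drop-∷-⊆ q))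

restrict-injective : ∀ {n} (R : Subset n) {A B} → restrict R A ≡ restrict R B → restrict (∁ R) A ≡ restrict (∁ R) B → A ≡ B
restrict-injective R {A} {B} p q = ⊆-antisym
  (restrict-⊆ R A B (⊆-reflexive p) (⊆-reflexive q))
  (restrict-⊆ R B A (⊆-reflexive (sym p)) (⊆-reflexive (sym q)))

⊆∧≢⇒⊂ : ∀ {n} {A B : Subset n} → A ⊆ B → A ≢ B → A ⊂ B
⊆∧≢⇒⊂ {A = A} {B} A⊆B A≢B with Fin.any? (λ i → (i ∈? B) ×-dec ¬? (i ∈? A))
... | yes some = A⊆B , some
... | no none  = ⊥-elim (A≢B (⊆-antisym A⊆B B⊆A))
  where
  B⊆A : B ⊆ A
  B⊆A {i} i∈B with i ∈? A
  ... | yes i∈A = i∈A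
  ... | no i∉A  = ⊥-elim (none (i , i∈B , i∉A))

x∈p─q⇒x∉q : ∀ {n} (p q : Subset n) {x} → x ∈ p ─ q → ¬ (x ∈ q)
x∈p─q⇒x∉q (a ∷ p) (b ∷ q)     (there x∈) (there x∈q) = x∈p─q⇒x∉q p q x∈ x∈q

MonoAdjacent : ∀ {n} → Subset n → Subset n → Subset n → Set
MonoAdjacent R A B = CompMono R A B ⊎ CompMono R B A

monoAdjacent? : ∀ {n} (R A B : Subset n) → Dec (MonoAdjacent R A B)
monoAdjacent? R A B = compMono? A B ⊎-dec compMono? B A
  where
  compMono? : ∀ A B → Dec (CompMono R A B)
  compMono? A B = (A ⊂? B) ×-dec (((B ─ A) ⊆? R) ⊎-dec ((B ─ A) ⊆? ∁ R))

-- Equal traces on `R` keep the difference out of `R`. The superscript names the colour of the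
-- difference.
edge⇒monoAdjacentᵂ : ∀ {n} (R : Subset n) {A B} → Edge (restrict R) (restrict (∁ R)) A B → MonoAdjacent R A B
edge⇒monoAdjacentᵂ R {A} {B} (x≡ , y≢ , y⊆) = [ inj₁ ∘ compMono x≡ y≢ , inj₂ ∘ compMono (sym x≡) (y≢ ∘ sym) ]′ y⊆
  where
  compMono : ∀ {A B} → restrict R A ≡ restrict R B → restrict (∁ R) A ≢ restrict (∁ R) B →
             restrict (∁ R) A ⊆ restrict (∁ R) B → CompMono R A B
  compMono {A} {B} x≡ y≢ y⊆ =
    ⊆∧≢⇒⊂ (restrict-⊆ R A B (⊆-reflexive x≡) y⊆) (y≢ ∘ cong (restrict (∁ R))) ,
    inj₂ λ i∈ → x∉p⇒x∈∁p λ i∈R → x∈p─q⇒x∉q B A i∈ (restrict-agree R A B x≡ i∈R (p─q⊆p B A i∈))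

edge⇒monoAdjacentᴿ : ∀ {n} (R : Subset n) {A B} → Edge (restrict (∁ R)) (restrict R) A B → MonoAdjacent R A B
edge⇒monoAdjacentᴿ R {A} {B} (y≡ , x≢ , x⊆) = [ inj₁ ∘ compMono y≡ x≢ , inj₂ ∘ compMono (sym y≡) (x≢ ∘ sym) ]′ x⊆
  where
  compMono : ∀ {A B} → restrict (∁ R) A ≡ restrict (∁ R) B → restrict R A ≢ restrict R B →
             restrict R A ⊆ restrict R B → CompMono R A B
  compMono {A} {B} y≡ x≢ x⊆ =
    ⊆∧≢⇒⊂ (restrict-⊆ R A B x⊆ (⊆-reflexive y≡)) (x≢ ∘ cong (restrict R)) ,
    inj₁ difference⊆R
    where
    difference⊆R : (B ─ A) ⊆ R
    difference⊆R {i} i∈ with i ∈? R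
    ... | yes i∈R = i∈R
    ... | no i∉R  = contradiction (restrict-agree (∁ R) A B y≡ (x∉p⇒x∈∁p i∉R) (p─q⊆p B A i∈)) (x∈p─q⇒x∉q B A i∈)

-- Upper bound

module UpperBound (j n : ℕ) (params : Parameters (5 * suc j) n) where

  open Parameters params
  open ≤-Reasoning

  -- The exponent exceeds `c` by five units of `c / κ`: three from the degree bound, one from the
  -- partitions, one from the branching. Then `(κ + 5) / κ` is exactly `suc (suc j) / suc j`.
  κ = 5 * suc j
  c = central n
  M = (3 + κ) * c / κ

  instance _ = k≢0

  κM≤ : κ * M ≤ (3 + κ) * c
  κM≤ = ≤-trans (≤-reflexive (*-comm κ M)) (m/n*n≤m ((3 + κ) * c) κ)

  module _ (R : Subset n) where

    open Container {Subset n} _≟ˢ_ code code-injective code-surjective (MonoAdjacent R) (monoAdjacent? R)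

    -- Edges of both kinds are monochromatically adjacent, so small closed neighbourhoods bound both
    -- degrees in `degree-bound`. The contrapositive supplies the branching vertex.
    sparse⇒small : ∀ V → Unique V → (∀ {A} → A ∈ˡ V → length (filter (closed? A) V) ≤ d) → length V ≤ M
    sparse⇒small V V# deg = begin
      length V                ≡⟨ m*n/n≡m (length V) κ ⟨
      length V * κ / κ        ≤⟨ /-monoˡ-≤ κ (≤-trans (≤-reflexive (*-comm (length V) κ)) bound) ⟩
      M                       ∎
      where
      r+w≡n : ∣ R ∣ + ∣ ∁ R ∣ ≡ n
      r+w≡n = trans (cong (∣ R ∣ +_) (∣∁p∣≡n∸∣p∣ R)) (m+[n∸m]≡n (∣p∣≤n R))
      degree : ∀ {A} {E : Subset n → Set} (E? : ∀ B → Dec (E B)) → (∀ B → E B → MonoAdjacent R A B) →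
               A ∈ˡ V → ∑ V (λ B → 𝟙 (E? B)) ≤ d
      degree {A} E? E⇒ A∈ = begin
        ∑ V (λ B → 𝟙 (E? B))              ≤⟨ ∑-mono V (λ B → 𝟙-mono (E? B) (closed? A B) (inj₂ ∘ E⇒ B)) ⟩
        ∑ V (λ B → 𝟙 (closed? A B))       ≡⟨ length-filter-∑ (closed? A) V ⟨
        length (filter (closed? A) V)     ≤⟨ deg A∈ ⟩
        d                                 ∎
      bound : κ * length V ≤ (3 + κ) * c
      bound = subst (λ m → κ * length V ≤ (3 + κ) * central m) r+w≡n
        (degree-bound (restrict R) (restrict (∁ R)) (restrict-injective R) κ d
          (≤-trans sparse (≤-reflexive (sym r+w≡n))) (≤-trans large (≤-reflexive (sym r+w≡n))) V V#
          (λ {A} → degree (edge? (restrict R) (restrict (∁ R)) A) (λ _ → edge⇒monoAdjacentᵂ R))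
          (λ {A} → degree (edge? (restrict (∁ R)) (restrict R) A) (λ _ → edge⇒monoAdjacentᴿ R)))

    dense : ∀ V → Unique V → M < length V → ∃ λ A → A ∈ˡ V × d < length (filter (closed? A) V)
    dense V V# M<V with any? (λ A → d <? length (filter (closed? A) V)) V
    ... | yes some = find some
    ... | no none  = contradiction (sparse⇒small V V# λ A∈ → ≮⇒≥ λ d< → none (lose A∈ d<)) (<⇒≱ M<V)

    avoiding : ∃ λ L → (∀ 𝓕 → AvoidsFor R 𝓕 → 𝓕 ∈ˡ L) × length L ^ k ≤ 2 ^ (M * k + 2 ^ n)
    avoiding with container M d k branching dense (subsets n) (subsets-unique n)
    ... | L , cov , L≤ = L ,
      (λ 𝓕 av → cov 𝓕 (λ A∈ B∈ → λ { (inj₁ A~B) → av (_ , _ , A∈ , B∈ , A~B) ; (inj₂ B~A) → av (_ , _ , B∈ , A∈ , B~A) })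
                     (λ {A} _ → ∈-subsets A)) ,
      subst (λ m → length L ^ k ≤ 2 ^ (M * k + m)) (length-subsets n) L≤

  good : List (Family n)
  good = concatMap (proj₁ ∘ avoiding) (subsets n)

  numGood^k≤ : numGood n ^ k ≤ 2 ^ (n * k + (M * k + 2 ^ n))
  numGood^k≤ = begin
    numGood n ^ k                                                 ≤⟨ ^-monoˡ-≤ k (count≤length (good? n) good complete) ⟩
    length good ^ k                                               ≡⟨ cong (_^ k) length-good ⟩
    ∑ (subsets n) (λ R → length (proj₁ (avoiding R))) ^ k         ≤⟨ ∑-^-bound k (subsets n) _ (2 ^ (M * k + 2 ^ n)) (λ R → proj₂ (proj₂ (avoiding R))) ⟩
    length (subsets n) ^ k * 2 ^ (M * k + 2 ^ n)                  ≡⟨ cong (_* 2 ^ (M * k + 2 ^ n)) (trans (cong (_^ k) (length-subsets n)) (^-*-assoc 2 n k)) ⟩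
    2 ^ (n * k) * 2 ^ (M * k + 2 ^ n)                             ≡⟨ ^-distribˡ-+-* 2 (n * k) _ ⟨
    2 ^ (n * k + (M * k + 2 ^ n))                                 ∎
    where
    complete : ∀ 𝓕 → Good n 𝓕 → 𝓕 ∈ˡ good
    complete 𝓕 (R , av) = ∈-concatMap⁺ (proj₁ ∘ avoiding) (lose (∈-subsets R) (proj₁ (proj₂ (avoiding R)) 𝓕 av))
    length-good : length good ≡ ∑ (subsets n) (λ R → length (proj₁ (avoiding R)))
    length-good = trans (length≡∑1 good) (trans (∑-concatMap (proj₁ ∘ avoiding) (subsets n) _)
      (∑-cong (subsets n) λ R → sym (length≡∑1 (proj₁ (avoiding R)))))

  exponent≤ : (n * k + (M * k + 2 ^ n)) * suc j ≤ c * suc (suc j) * k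
  exponent≤ = *-cancelˡ-≤ κ (begin
    κ * ((n * k + (M * k + 2 ^ n)) * suc j)                       ≡⟨ lemma κ n k M (2 ^ n) (suc j) ⟩
    (κ * n * k + (κ * M * k + κ * 2 ^ n)) * suc j                 ≤⟨ *-monoˡ-≤ (suc j) (+-mono-≤ (*-monoˡ-≤ k few-partitions) (+-mono-≤ (*-monoˡ-≤ k κM≤) few-vertices)) ⟩
    (c * k + ((3 + κ) * c * k + k * c)) * suc j                   ≡⟨ lemma′ c k j ⟩
    κ * (c * suc (suc j) * k)                                     ∎)
    where
    lemma : ∀ κ n k M t s → κ * ((n * k + (M * k + t)) * s) ≡ (κ * n * k + (κ * M * k + κ * t)) * s
    lemma = solve-∀
    lemma′ : ∀ c k j → (c * k + ((3 + 5 * suc j) * c * k + k * c)) * suc j ≡ 5 * suc j * (c * suc (suc j) * k)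
    lemma′ = solve-∀

  ^-cancelˡ-≤ : ∀ k .{{_ : NonZero k}} {a b} → a ^ k ≤ b ^ k → a ≤ b
  ^-cancelˡ-≤ k a^k≤b^k = ≮⇒≥ λ b<a → <-irrefl refl (<-≤-trans (^-monoˡ-< k b<a) a^k≤b^k)

  ^-swap : ∀ a k m → (a ^ m) ^ k ≡ (a ^ k) ^ m
  ^-swap a k m = trans (^-*-assoc a m k) (trans (cong (a ^_) (*-comm m k)) (sym (^-*-assoc a k m)))

  -- The exponent `2 ^ n / k` need not be an integer, so the `k`th power is carried along and
  -- cancelled only here.
  upper-bound : numGood n ^ suc j ≤ 2 ^ (c * suc (suc j))
  upper-bound = ^-cancelˡ-≤ k (begin
    (numGood n ^ suc j) ^ k                           ≡⟨ ^-swap (numGood n) k (suc j) ⟩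
    (numGood n ^ k) ^ suc j                           ≤⟨ ^-monoˡ-≤ (suc j) numGood^k≤ ⟩
    (2 ^ (n * k + (M * k + 2 ^ n))) ^ suc j           ≡⟨ ^-*-assoc 2 (n * k + (M * k + 2 ^ n)) (suc j) ⟩
    2 ^ ((n * k + (M * k + 2 ^ n)) * suc j)           ≤⟨ ^-monoʳ-≤ 2 exponent≤ ⟩
    2 ^ (c * suc (suc j) * k)                         ≡⟨ ^-*-assoc 2 (c * suc (suc j)) k ⟨
    (2 ^ (c * suc (suc j))) ^ k                       ∎)

-- Lower bound from the middle layer

layer lower-layer : ∀ n → ℕ → Family n
layer zero    zero    = inside ∷ []
layer zero    (suc i) = outside ∷ []
-- `code` lists the sets without element 0 before those with it, whose remaining elements number one
-- less than `i`. The final `[]` matches `2 ^ suc n` unfolding to `2 ^ n + (2 ^ n + 0)`.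
layer (suc n) i       = layer n i Vec.++ (lower-layer n i Vec.++ [])
lower-layer n zero    = ⊥
lower-layer n (suc i) = layer n i

∣++∣ : ∀ {m n} (p : Subset m) (q : Subset n) → ∣ p Vec.++ q ∣ ≡ ∣ p ∣ + ∣ q ∣
∣++∣ []          q = refl
∣++∣ (true ∷ p)  q = cong suc (∣++∣ p q)
∣++∣ (false ∷ p) q = ∣++∣ p q

∣layer∣ : ∀ n i → ∣ layer n i ∣ ≡ n C i
∣layer∣ zero    zero    = refl
∣layer∣ zero    (suc i) = refl
∣layer∣ (suc n) i       = trans (∣++∣ (layer n i) _) (trans (cong (∣ layer n i ∣ +_) (trans (∣++∣ (lower-layer n i) []) (+-identityʳ _))) (pascal i))
  where
  pascal : ∀ i → ∣ layer n i ∣ + ∣ lower-layer n i ∣ ≡ suc n C i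
  pascal zero    = trans (cong₂ _+_ (∣layer∣ n 0) (∣⊥∣≡0 (2 ^ n))) refl
  pascal (suc i) = trans (+-comm ∣ layer n (suc i) ∣ _) (trans (cong₂ _+_ (∣layer∣ n i) (∣layer∣ n (suc i))) (nCk+nC[k+1]≡[n+1]C[k+1] n i))

∈-layer : ∀ n i (A : Subset n) → A ∈𝓕 layer n i → ∣ A ∣ ≡ i
∈-layer zero    zero    []          A∈ = refl
∈-layer zero    (suc i) []          ()
∈-layer (suc n) i       (false ∷ A) A∈ = ∈-layer n i A (lookup⇒[]= (code A) (layer n i)
  (trans (sym (lookup-++ˡ (layer n i) (lower-layer n i Vec.++ []) (code A))) ([]=⇒lookup A∈)))
∈-layer (suc n) i       (true ∷ A)  A∈ = below i (lookup⇒[]= (code A) (lower-layer n i)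
  (trans (sym (trans (lookup-++ʳ (layer n i) (lower-layer n i Vec.++ []) (code A ↑ˡ 0)) (lookup-++ˡ (lower-layer n i) [] (code A)))) ([]=⇒lookup A∈)))
  where
  below : ∀ i → code A ∈ lower-layer n i → suc ∣ A ∣ ≡ i
  below zero    A∈ = ⊥-elim (∉⊥ A∈)
  below (suc i) A∈ = cong suc (∈-layer n i A A∈)

2^≤count : ∀ {m} {P : Subset m → Set} (P? : ∀ s → Dec (P s)) T → (∀ {s} → s ⊆ T → P s) → 2 ^ ∣ T ∣ ≤ count P?
2^≤count P? [] ⊆T⇒P with P? []
... | yes _ = ≤-refl
... | no ¬p = contradiction (⊆T⇒P id) ¬p
2^≤count P? (true ∷ T) ⊆T⇒P = +-mono-≤
  (2^≤count (P? ∘ (inside ∷_)) T (⊆T⇒P ∘ in⊆in))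
  (≤-trans (≤-reflexive (+-identityʳ _)) (2^≤count (P? ∘ (outside ∷_)) T (⊆T⇒P ∘ out⊆)))
2^≤count P? (false ∷ T) ⊆T⇒P = ≤-trans (2^≤count (P? ∘ (outside ∷_)) T (⊆T⇒P ∘ out⊆)) (m≤n+m _ _)

-- Sets of equal size are never strictly nested, so every partition is a witness; `⊥` is picked.
⊆layer⇒good : ∀ n i {𝓕 : Family n} → 𝓕 ⊆ layer n i → Good n 𝓕
⊆layer⇒good n i 𝓕⊆ = ⊥ , λ (A , B , A∈ , B∈ , A⊂B , _) →
  <-irrefl (trans (∈-layer n i A (𝓕⊆ A∈)) (sym (∈-layer n i B (𝓕⊆ B∈)))) (p⊂q⇒∣p∣<∣q∣ A⊂B)

lower-bound : ∀ n → 2 ^ central n ≤ numGood n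
lower-bound n = subst (λ m → 2 ^ m ≤ numGood n) (∣layer∣ n ⌊ n /2⌋) (2^≤count (good? n) (layer n ⌊ n /2⌋) (⊆layer⇒good n ⌊ n /2⌋))

-- The o(1) is expressed by ε = 1 / (j + 1): the exponent of 2 lies eventually between 1 - ε and 1 +
-- ε times the central coefficient. Raising to the power `suc j` clears the denominator.
theorem7p6 : (j : ℕ) → Σ ℕ (λ N₀ → (n : ℕ) → N₀ ≤ n →
    (2 ^ ((n C (n / 2)) * j) ≤ numGood n ^ suc j)
    × (numGood n ^ suc j ≤ 2 ^ ((n C (n / 2)) * suc (suc j))))
theorem7p6 j = proj₁ (parameters (5 * suc j)) , λ n N₀≤n → lower n , upper n (proj₂ (parameters (5 * suc j)) n N₀≤n)
  where
  open ≤-Reasoning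
  central≡ : ∀ n → central n ≡ n C (n / 2)
  central≡ n = cong (n C_) (sym (/2≡⌊/2⌋ n))
  lower : ∀ n → 2 ^ ((n C (n / 2)) * j) ≤ numGood n ^ suc j
  lower n = begin
    2 ^ ((n C (n / 2)) * j)            ≤⟨ ^-monoʳ-≤ 2 (*-monoʳ-≤ (n C (n / 2)) (n≤1+n j)) ⟩
    2 ^ ((n C (n / 2)) * suc j)        ≡⟨ ^-*-assoc 2 (n C (n / 2)) (suc j) ⟨
    (2 ^ (n C (n / 2))) ^ suc j        ≤⟨ ^-monoˡ-≤ (suc j) (subst (λ m → 2 ^ m ≤ numGood n) (central≡ n) (lower-bound n)) ⟩
    numGood n ^ suc j                  ∎
  upper : ∀ n → Parameters (5 * suc j) n → numGood n ^ suc j ≤ 2 ^ ((n C (n / 2)) * suc (suc j))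
  upper n params = subst (λ m → numGood n ^ suc j ≤ 2 ^ (m * suc (suc j))) (central≡ n) (UpperBound.upper-bound j n params)
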